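{- Let $q$ be a positive integer with $q\equiv 1\pmod 6$. If there exist an LKTS$(q+2)$ and a CO$(q)$ (cubic orthomorphism of order $q$), then there exists an LKTS$(7q+2)$.
   Context: Steiner and Kirkman triple systems. A Steiner triple system STS$(v)$ is a pair $(X,\mathcal B)$, where $X$ is a $v$-set and $\mathcal B$ is a collection of $3$-subsets (blocks) of $X$ such that every pair of points of $X$ is contained in a unique block. A parallel class is a set of blocks that partitions $X$. An STS$(v)$ is resolvable if $\mathcal B$ can be partitioned into $(v-1)/2$ parallel classes (such a partition is a resolution); a resolvable STS$(v)$ is called a Kirkman triple system KTS$(v)$. Two STS$(v)$s on the same point set are disjoint if they have no common block. A large set of Steiner triple systems LSTS$(v)$ is a set of $v-2$ mutually disjoint STS$(v)$s on the same $v$-point set (equivalently, their block sets partition all triples of the point set). An LKTS$(v)$ is an LSTS$(v)$ in which every constituent STS$(v)$ is resolvable. Cubic orthomorphism. Let $q\equiv1\pmod 6$ be a positive integer. A cubic orthomorphism of order $q$, CO$(q)$, is a triple $(G,f,G^+)$, where $G$ is an abelian group (written additively) of order $q$, $f$ is a permutation of $G$, and $G^+\subseteq G$ is such that $G$ is the disjoint union of $\{0\}$, $G^+$ and $-G^+$, satisfying: (1) the map $a\mapsto f(a)-a$ is a bijection of $G$; (2) $f(-a)=-f(a)$ for every $a\in G$ (in particular $f(0)=0$); (3) $f$ has cycle type $1^1 3^{(q-1)/3}$ (i.e. $0$ is the only fixed point and all other cycles have length $3$); (4) $f(G^+)=G^+$; (5) $a+f(a)+f^2(a)=0$ for every $a\in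 G$; (6) for every $b\in G$, the map $a\mapsto f^2(a)+f(b-a)$ is a bijection of $G$; (7) for every $b\in G$, the two sets $\{a+f(b)-f(a+b):a\in G^+\}$ and $\{f^2(a)+f(b)-f(a+b):a\in G^+\}$ form a partition of $G\setminus\{0\}$. Here $f^2(a)=f(f(a))$. -}

module Defs where

open import Algebra.Bundles using (AbelianGroup)
open import Data.Fin.Base using (Fin)
open import Data.Fin.Subset using (Subset; ∣_∣) renaming (_∈_ to _∈ₛ_)
open import Data.Nat.Base using (ℕ; _∸_; _/_; _<_)
open import Data.Nat.GeneralisedArithmetic using (iterate)
open import Data.Product.Base using (Σ-syntax; ∃; _×_)
open import Data.Product using (∃!)
open import Data.Vec.Functional using (Vector; []; _∷_)
open import Function.Bundles using (Inverse)
open import Function.Structures using (IsBijection)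
open import Level using (Level; 0ℓ)
open import Relation.Binary.PropositionalEquality using (_≡_; _≢_; setoid)
open import Relation.Nullary.Negation.Core using (¬_)
open import Relation.Unary using (Pred; U; _∈_; _⊆_; _≐_; _⊥_)

private
  variable
    a ℓ ℓ′ : Level
    A : Set a
    n v : ℕ

-- The parts may be empty: for q = 1 below the sets G⁺ and -G⁺ are.
IsPartition : Vector (Pred A ℓ) n → Pred A ℓ′ → Set _
IsPartition P S =
  (∀ i → P i ⊆ S) × (∀ {x} → x ∈ S → ∃! _≡_ λ i → x ∈ P i)

-- The v-set of points is Fin v.
BlockSet : ℕ → Set₁
BlockSet v = Pred (Subset v) 0ℓ

record IsSTS (𝓑 : BlockSet v) : Set where
  field
    block-size  : ∀ {B} → B ∈ 𝓑 → ∣ B ∣ ≡ 3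
    pair-unique : ∀ {x y} → x ≢ y →
                  ∃! _≡_ λ B → B ∈ 𝓑 × x ∈ₛ B × y ∈ₛ B

IsParallelClass : BlockSet v → BlockSet v → Set
IsParallelClass 𝓑 𝓟 = 𝓟 ⊆ 𝓑 × (∀ x → ∃! _≡_ λ B → B ∈ 𝓟 × x ∈ₛ B)

Resolvable : BlockSet v → Set₁
Resolvable {v} 𝓑 =
  Σ[ 𝓟 ∈ Vector (BlockSet v) ((v ∸ 1) / 2) ]
    (∀ i → IsParallelClass 𝓑 (𝓟 i)) × IsPartition 𝓟 𝓑

record IsLSTS (𝓛 : Vector (BlockSet v) (v ∸ 2)) : Set where
  field
    isSTS    : ∀ i → IsSTS (𝓛 i)
    disjoint : ∀ {i j} → i ≢ j → 𝓛 i ⊥ 𝓛 j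

record LKTS (v : ℕ) : Set₁ where
  field
    systems    : Vector (BlockSet v) (v ∸ 2)
    isLSTS     : IsLSTS systems
    resolvable : ∀ i → Resolvable (systems i)

record CubicOrthomorphism (q : ℕ) : Set₁ where
  field
    G : AbelianGroup 0ℓ 0ℓ

  open AbelianGroup G public
    using (Carrier; _≈_; _≉_; _-_)
    renaming (_∙_ to _+_; ε to 0#; _⁻¹ to -_; setoid to G-setoid)

  IsPermutation : (Carrier → Carrier) → Set
  IsPermutation = IsBijection _≈_ _≈_

  Image : (Carrier → Carrier) → Pred Carrier 0ℓ → Pred Carrier 0ℓ
  Image φ S y = ∃ λ x → x ∈ S × φ x ≈ y

  HasCycleLength : (Carrier → Carrier) → Carrier → ℕ → Set
  HasCycleLength φ x k =
    0 < k × iterate φ x k ≈ x × (∀ {j} → 0 < j → j < k → ¬ (iterate φ x j ≈ x))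

  field
    order : Inverse G-setoid (setoid (Fin q))

    f             : Carrier → Carrier
    f-permutation : IsPermutation f

    G⁺           : Pred Carrier 0ℓ
    G⁺-resp-≈    : ∀ {x y} → x ≈ y → x ∈ G⁺ → y ∈ G⁺
    G⁺-partition : IsPartition ((_≈ 0#) ∷ G⁺ ∷ Image -_ G⁺ ∷ []) U

    orthomorphism : IsPermutation (λ a → f a - a)
    odd           : ∀ a → f (- a) ≈ - f a

    -- Cycle type 1¹ 3^((q-1)/3), with 0 as the fixed point.
    cycle-zero    : HasCycleLength f 0# 1
    cycle-nonzero : ∀ {a} → a ≉ 0# → HasCycleLength f a 3

    f-G⁺     : Image f G⁺ ≐ G⁺
    sum-zero : ∀ a → (a + f a) + f (f a) ≈ 0#

    shift-permutation : ∀ b → IsPermutation (λ a → f (f a) + f (b - a))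

    difference-partition : ∀ b →
      IsPartition
        ( Image (λ a → (a + f b) - f (a + b)) G⁺
        ∷ Image (λ a → (f (f a) + f b) - f (a + b)) G⁺
        ∷ [])
        (_≉ 0#)

{-# OPTIONS --safe #-}
-- Let ω act on G as f and on ℤ/7 as 2; the unit ±2^e then acts on G as ±f^e. The points are those of
-- ℤ/7 × G and two points ∞, and the 7q systems are translates of base systems by the elements
-- (m , x) of ℤ/7 × G. A base system contains the x-th given KTS(q + 2) on {0} × G ∪ {∞}. Each of the
-- q lines {(i , i g)}, g ∈ G, is completed with the points ∞ to an affine plane of order 3. The other
-- blocks have residues with sum 0 modulo 7. Relative to a line they are
--   (i , l - a), (i , l - f a), (-2i , a - f l)        for a ∈ G⁺,
--   (i , l + a), (2i , f l + f²a), (4i , f²l + f a)    for a ≠ 0,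
--   (0 , u), (i , l - f u), (-i , - l - f²u)           for u ≠ 0.
-- Condition (7) says that the first kind joins the residues i and -2i, the lines accounting for the
-- excluded difference 0; condition (6) says that the second kind joins i and 2i.
-- Blocks of the second kind with a fixed a ∈ -G⁺ complete a parallel class of the KTS(q + 2). For a
-- line and a cycle of f in G⁺, the 42 points at an offset ±ω^t y from the line are covered once by the
-- 14 blocks listed in frame-step, in three ways k rotated into each other by ω. With a parallel class
-- of the affine plane this gives the other 3q parallel classes.
-- It suffices to show that all pairs and triples are covered: uniqueness and disjointness follow by
-- counting.
module Submission where

open import Defs
open import Algebra.Bundles using (AbelianGroup)
open import Algebra.Structures using (IsAbelianGroup)
open import Algebra.Morphism.Structures using (IsGroupMonomorphism)
import Algebra.Morphism.GroupMonomorphism as GroupMonomorphism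
import Algebra.Properties.AbelianGroup as AbelianGroupProperties
import Algebra.Properties.CommutativeSemigroup as CommutativeSemigroupProperties
import Algebra.Properties.CommutativeMonoid.Sum as CommutativeMonoidSum
import Algebra.Properties.Monoid.Mult as MonoidMult
open import Data.Bool.Base using (Bool; true; false; not)
import Data.Bool.Properties as Bool
open import Data.Fin.Base using (Fin; zero; suc; toℕ; punchOut)
open import Data.Fin.Patterns using (0F; 1F; 2F; 3F; 4F)
open import Data.Fin.Permutation using (↔⇒≡)
open import Data.Fin.Properties as Fin
  using (_≟_; all?; any?; injective⇒≤; punchOut-injective; suc-injective; toℕ-injective;
         +↔⊎; *↔×; 1↔⊤; 2↔Bool)
open import Data.Fin.Subset using (Subset; ∣_∣; ⁅_⁆; _∪_; inside; outside)
  renaming (_∈_ to _∈ₛ_; _∉_ to _∉ₛ_; _⊆_ to _⊆ₛ_)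
open import Data.Fin.Subset.Properties
  using (x∈⁅x⁆; x∈⁅y⁆⇒x≡y; x∈p∪q⁺; x∈p∪q⁻; ⊆-antisym; _∈?_; ∪-identityˡ; ∣⁅x⁆∣≡1)
open import Data.Maybe using (Is-just; to-witness)
open import Data.Maybe.Base as Maybe using (Maybe; just; nothing; _<∣>_)
import Data.Maybe.Properties as Maybe
import Data.Maybe.Relation.Unary.Any as MaybeAny
open import Data.Nat.Base as ℕ using (ℕ; zero; suc; _∸_; _/_)
open import Data.Nat.DivMod using (m*n/n≡m)
open import Data.Nat.Properties as ℕ using (1+n≰n; m+n∸n≡m; +-comm)
open import Data.Nat.Tactic.RingSolver using (solve-∀)
open import Data.Product using (∃!)
open import Data.Product.Base using (Σ-syntax; ∃; ∃₂; _×_; _,_; proj₁; proj₂; map₂)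
open import Data.Product.Function.NonDependent.Propositional using (_×-↔_)
open import Data.Product.Properties using (≡-dec)
open import Data.Sign.Base using (Sign; opposite) renaming (+ to ⁺; - to ⁻)
import Data.Sign.Properties as Sign
open import Data.Sum.Base using (_⊎_; inj₁; inj₂; [_,_]′; swap)
open import Data.Sum.Function.Propositional using (_⊎-↔_)
open import Data.Sum.Properties using (inj₂-injective)
open import Data.Unit.Base using (⊤; tt)
open import Data.Vec.Base using (Vec; []; _∷_; here; there; lookup; zipWith; replicate; tabulate)
open import Data.Vec.Properties using (lookup∘tabulate; lookup⇒[]=; []=⇒lookup)
open import Function.Base using (_∘_)
open import Function.Bundles using (_↔_; Injection; Inverse; mk↔ₛ′)
open import Function.Construct.Composition using (_↔-∘_)
open import Function.Construct.Symmetry using (↔-sym)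
open import Function.Definitions using (Injective)
open import Function.Properties.Inverse using (↔⇒↣; ↔-refl)
open import Function.Structures using (IsBijection)
open import Level using (0ℓ)
open import Relation.Binary.Definitions using (DecidableEquality)
open import Relation.Binary.PropositionalEquality
import Relation.Binary.Reasoning.Setoid as SetoidReasoning
open import Relation.Nullary using (¬_; Dec; yes; no; does; contradiction)
open import Relation.Nullary.Decidable using (_×-dec_; map′; dec-true; True; toWitness)
open import Relation.Unary using (Pred; Decidable)

-- Counting: injective and surjective maps between finite sets of equal size

↔-injective : {A B : Set} (e : A ↔ B) → Injective _≡_ _≡_ (Inverse.to e)
↔-injective e = Injection.injective (↔⇒↣ e)

-- Pigeonhole: if `j` were missed, punching it out would embed `Fin (suc n)` in `Fin n`.
injective⇒onto : ∀ {n} {f : Fin n → Fin n} → Injective _≡_ _≡_ f → ∀ j → ∃ λ i → f i ≡ j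
injective⇒onto {suc n} {f} f-inj j with any? (λ i → f i ≟ j)
... | yes ∃i = ∃i
... | no ∄i  = contradiction
  (injective⇒≤ {f = λ i → punchOut (λ j≡fi → ∄i (i , sym j≡fi))}
    (f-inj ∘ punchOut-injective (λ eq → ∄i (_ , sym eq)) (λ eq → ∄i (_ , sym eq))))
  1+n≰n

-- A choice `g` of preimages is injective, hence onto, so `g` is a left inverse of `f` as well as a
-- right inverse.
onto⇒injective : ∀ {n} {f : Fin n → Fin n} → (∀ j → ∃ λ i → f i ≡ j) → Injective _≡_ _≡_ f
onto⇒injective {f = f} f-onto {i} {j} fi≡fj = begin
  i         ≡⟨ section-onto i ⟨
  g (f i)   ≡⟨ cong g fi≡fj ⟩
  g (f j)   ≡⟨ section-onto j ⟩
  j         ∎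
  where
  open ≡-Reasoning
  g = λ k → proj₁ (f-onto k)
  g-injective : Injective _≡_ _≡_ g
  g-injective {k} {l} gk≡gl =
    trans (sym (proj₂ (f-onto k))) (trans (cong f gk≡gl) (proj₂ (f-onto l)))
  section-onto : ∀ k → g (f k) ≡ k
  section-onto k with l , gl≡k ← injective⇒onto g-injective k =
    trans (cong (g ∘ f) (sym gl≡k)) (trans (cong g (proj₂ (f-onto l))) gl≡k)

module _ {n} {A B : Set} (A↔ : A ↔ Fin n) (B↔ : B ↔ Fin n) {F : A → B} where
  private
    module A = Inverse A↔
    module B = Inverse B↔
    F′ : Fin n → Fin n
    F′ = B.to ∘ F ∘ A.from

  onto⇒injective-↔ : (∀ b → ∃ λ a → F a ≡ b) → Injective _≡_ _≡_ F
  onto⇒injective-↔ F-onto {x} {y} Fx≡Fy = begin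
    x                 ≡⟨ A.strictlyInverseʳ x ⟨
    A.from (A.to x)   ≡⟨ cong A.from (onto⇒injective F′-onto F′x≡F′y) ⟩
    A.from (A.to y)   ≡⟨ A.strictlyInverseʳ y ⟩
    y                 ∎
    where
    open ≡-Reasoning
    F′-onto : ∀ j → ∃ λ i → F′ i ≡ j
    F′-onto j with a , Fa≡ ← F-onto (B.from j) =
      A.to a , trans (cong (B.to ∘ F) (A.strictlyInverseʳ a))
                     (trans (cong B.to Fa≡) (B.strictlyInverseˡ j))
    F′x≡F′y : F′ (A.to x) ≡ F′ (A.to y)
    F′x≡F′y rewrite A.strictlyInverseʳ x | A.strictlyInverseʳ y = cong B.to Fx≡Fy

  injective⇒onto-↔ : Injective _≡_ _≡_ F → ∀ b → ∃ λ a → F a ≡ b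
  injective⇒onto-↔ F-inj b = map-preimage (injective⇒onto F′-inj (B.to b))
    where
    F′-inj : Injective _≡_ _≡_ F′
    F′-inj eq = ↔-injective (↔-sym A↔) (F-inj (↔-injective B↔ eq))
    map-preimage : (∃ λ i → F′ i ≡ B.to b) → ∃ λ a → F a ≡ b
    map-preimage (i , eq) = A.from i , ↔-injective B↔ eq

-- Large sets described by maps of order 3

record Triple {V : Set} (n : V → V) (x y z : V) : Set where
  constructor _,_
  field
    first  : n x ≡ y
    second : n y ≡ z

-- When `n` has order 3, `Triple n` is invariant under rotation of its points, so these two cases
-- account for all six orders of a block.
Block : {V : Set} → (V → V) → V → V → V → Set
Block n x y z = Triple n x y z ⊎ Triple n y x z

Joins : {C V : Set} → (C → V → V) → Set
Joins n = ∀ {x y} → x ≢ y → ∃₂ λ c z → Block (n c) x y z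

-- A parallel class is encoded by a map all of whose orbits are its blocks, each traversed
-- cyclically. That these orbits have length exactly 3, that a pair of points lies in only one block
-- and that different systems are disjoint is forced by joins and covers when
-- |V| = 1 + 2|C| = 2 + |S|.
record KirkmanLargeSet (S C V : Set) : Set where
  field
    next   : S → C → V → V
    next³  : ∀ s c x → next s c (next s c (next s c x)) ≡ x
    joins  : ∀ s → Joins (next s)
    covers : ∀ {x y z} → x ≢ y → y ≢ z → x ≢ z → ∃₂ λ s c → Block (next s c) x y z

module _ {V : Set} {n : V → V} (n³ : ∀ x → n (n (n x)) ≡ x) where

  Triple-rotate : ∀ {x y z} → Triple n x y z → Triple n y z x
  Triple-rotate (refl , refl) = refl , n³ _

  Block-rotate : ∀ {x y z} → Block n x y z → Block n y z x
  Block-rotate (inj₁ t) = inj₁ (Triple-rotate t)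
  Block-rotate (inj₂ t) = inj₂ (Triple-rotate (Triple-rotate t))

  Block-swap : ∀ {x y z} → Block n x y z → Block n y x z
  Block-swap = swap

conjugate : {V W : Set} → V ↔ W → (V → V) → W → W
conjugate e n = Inverse.to e ∘ n ∘ Inverse.from e

module _ {V W : Set} (e : V ↔ W) {n : V → V} where
  open Inverse e

  conjugate-cube : (∀ x → n (n (n x)) ≡ x) →
    ∀ x → conjugate e n (conjugate e n (conjugate e n x)) ≡ x
  conjugate-cube n³ x
    rewrite strictlyInverseʳ (n (from x))
          | strictlyInverseʳ (n (n (from x)))
          | n³ (from x) = strictlyInverseˡ x

  conjugate-Triple : ∀ {x y z} → Triple n (from x) (from y) (from z) →
    Triple (conjugate e n) x y z
  conjugate-Triple (p , q) =
    trans (cong to p) (strictlyInverseˡ _) , trans (cong to q) (strictlyInverseˡ _)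

  conjugate-Block : ∀ {x y z} → Block n (from x) (from y) (from z) →
    Block (conjugate e n) x y z
  conjugate-Block (inj₁ t) = inj₁ (conjugate-Triple t)
  conjugate-Block (inj₂ t) = inj₂ (conjugate-Triple t)

conjugate-joins : ∀ {C V W : Set} (e : V ↔ W) {n : C → V → V} → Joins n → Joins (conjugate e ∘ n)
conjugate-joins e {n} joins {x} {y} x≢y
  with c , z , b ← joins {Inverse.from e x} {Inverse.from e y} (x≢y ∘ ↔-injective (↔-sym e)) =
  c , Inverse.to e z , conjugate-Block e
    (subst (Block (n c) _ _) (sym (Inverse.strictlyInverseʳ e z)) b)

relabel : ∀ {S S′ C C′ V V′ : Set} → S ↔ S′ → C ↔ C′ → V ↔ V′ →
  KirkmanLargeSet S C V → KirkmanLargeSet S′ C′ V′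
relabel {S′ = S′} {C′ = C′} {V′ = V′} s↔ c↔ v↔ K = record
  { next   = next′
  ; next³  = λ s c → conjugate-cube v↔ {next (S.from s) (C.from c)} (next³ (S.from s) (C.from c))
  ; joins  = joins′
  ; covers = covers′
  }
  where
  open KirkmanLargeSet K
  module S = Inverse s↔
  module C = Inverse c↔
  module V = Inverse v↔
  next′ : S′ → C′ → V′ → V′
  next′ s c = conjugate v↔ (next (S.from s) (C.from c))
  joins′ : ∀ s → Joins (next′ s)
  joins′ s x≢y with c , z , b ← conjugate-joins v↔ (joins (S.from s)) x≢y =
    C.to c , z , subst (λ c → Block (conjugate v↔ (next (S.from s) c)) _ _ _)
      (sym (C.strictlyInverseʳ c)) b
  from-injective : ∀ {x y} → x ≢ y → V.from x ≢ V.from y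
  from-injective x≢y = x≢y ∘ ↔-injective (↔-sym v↔)
  covers′ : ∀ {x y z} → x ≢ y → y ≢ z → x ≢ z → ∃₂ λ s c → Block (next′ s c) x y z
  covers′ {x} {y} {z} x≢y y≢z x≢z
    with s , c , b ← covers (from-injective x≢y) (from-injective y≢z) (from-injective x≢z) =
    S.to s , C.to c , conjugate-Block v↔
      (subst₂ (λ s c → Block (next s c) (V.from x) (V.from y) (V.from z))
        (sym (S.strictlyInverseʳ s)) (sym (C.strictlyInverseʳ c)) b)

-- Three-element subsets and cyclic orders

⟪_,_,_⟫ : ∀ {v} → Fin v → Fin v → Fin v → Subset v
⟪ x , y , z ⟫ = ⁅ x ⁆ ∪ (⁅ y ⁆ ∪ ⁅ z ⁆)

module _ {v} {x y z : Fin v} where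

  ∈-triple⁻ : ∀ {w} → w ∈ₛ ⟪ x , y , z ⟫ → w ≡ x ⊎ w ≡ y ⊎ w ≡ z
  ∈-triple⁻ w∈ with x∈p∪q⁻ ⁅ x ⁆ _ w∈
  ... | inj₁ w∈x = inj₁ (x∈⁅y⁆⇒x≡y x w∈x)
  ... | inj₂ w∈yz with x∈p∪q⁻ ⁅ y ⁆ _ w∈yz
  ...   | inj₁ w∈y = inj₂ (inj₁ (x∈⁅y⁆⇒x≡y y w∈y))
  ...   | inj₂ w∈z = inj₂ (inj₂ (x∈⁅y⁆⇒x≡y z w∈z))

  ∈-triple₁ : x ∈ₛ ⟪ x , y , z ⟫
  ∈-triple₁ = x∈p∪q⁺ (inj₁ (x∈⁅x⁆ x))

  ∈-triple₂ : y ∈ₛ ⟪ x , y , z ⟫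
  ∈-triple₂ = x∈p∪q⁺ {p = ⁅ x ⁆} (inj₂ (x∈p∪q⁺ (inj₁ (x∈⁅x⁆ y))))

  ∈-triple₃ : z ∈ₛ ⟪ x , y , z ⟫
  ∈-triple₃ = x∈p∪q⁺ {p = ⁅ x ⁆} (inj₂ (x∈p∪q⁺ {p = ⁅ y ⁆} (inj₂ (x∈⁅x⁆ z))))

triple-⊆ : ∀ {v} {x y z : Fin v} {B : Subset v} → x ∈ₛ B → y ∈ₛ B → z ∈ₛ B → ⟪ x , y , z ⟫ ⊆ₛ B
triple-⊆ x∈ y∈ z∈ w∈ with ∈-triple⁻ w∈
... | inj₁ refl = x∈
... | inj₂ (inj₁ refl) = y∈
... | inj₂ (inj₂ refl) = z∈

triple-rotate : ∀ {v} (x y z : Fin v) → ⟪ x , y , z ⟫ ≡ ⟪ y , z , x ⟫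
triple-rotate x y z = ⊆-antisym
  (triple-⊆ (∈-triple₃ {x = y} {z} {x}) (∈-triple₁ {x = y} {z} {x}) (∈-triple₂ {x = y} {z} {x}))
  (triple-⊆ (∈-triple₂ {x = x} {y} {z}) (∈-triple₃ {x = x} {y} {z}) (∈-triple₁ {x = x} {y} {z}))

triple-swap : ∀ {v} (x y z : Fin v) → ⟪ x , y , z ⟫ ≡ ⟪ y , x , z ⟫
triple-swap x y z = ⊆-antisym
  (triple-⊆ (∈-triple₂ {x = y}) (∈-triple₁ {x = y}) (∈-triple₃ {x = y} {x}))
  (triple-⊆ (∈-triple₂ {x = x}) (∈-triple₁ {x = x}) (∈-triple₃ {x = x} {y}))

triple-third : ∀ {v} {x y z w : Fin v} → ⟪ x , y , z ⟫ ≡ ⟪ x , y , w ⟫ → x ≢ z → y ≢ z → z ≡ w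
triple-third {x = x} {y} {z} eq x≢z y≢z with ∈-triple⁻ (subst (z ∈ₛ_) eq (∈-triple₃ {x = x} {y}))
... | inj₁ z≡x        = contradiction (sym z≡x) x≢z
... | inj₂ (inj₁ z≡y) = contradiction (sym z≡y) y≢z
... | inj₂ (inj₂ z≡w) = z≡w

∣⁅x⁆∪p∣ : ∀ {v} {x : Fin v} {p} → x ∉ₛ p → ∣ ⁅ x ⁆ ∪ p ∣ ≡ suc ∣ p ∣
∣⁅x⁆∪p∣ {x = zero}  {outside ∷ p} x∉p = cong (suc ∘ ∣_∣) (∪-identityˡ p)
∣⁅x⁆∪p∣ {x = zero}  {inside ∷ p}  x∉p = contradiction here x∉p
∣⁅x⁆∪p∣ {x = suc x} {outside ∷ p} x∉p = ∣⁅x⁆∪p∣ (x∉p ∘ there)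
∣⁅x⁆∪p∣ {x = suc x} {inside ∷ p}  x∉p = cong suc (∣⁅x⁆∪p∣ (x∉p ∘ there))

∣triple∣ : ∀ {v} {x y z : Fin v} → x ≢ y → y ≢ z → x ≢ z → ∣ ⟪ x , y , z ⟫ ∣ ≡ 3
∣triple∣ {x = x} {y} {z} x≢y y≢z x≢z = begin
  ∣ ⟪ x , y , z ⟫ ∣          ≡⟨ ∣⁅x⁆∪p∣ {x = x} {⁅ y ⁆ ∪ ⁅ z ⁆} x∉yz ⟩
  suc ∣ ⁅ y ⁆ ∪ ⁅ z ⁆ ∣      ≡⟨ cong suc (∣⁅x⁆∪p∣ {x = y} {⁅ z ⁆} (y≢z ∘ x∈⁅y⁆⇒x≡y z)) ⟩
  2 ℕ.+ ∣ ⁅ z ⁆ ∣            ≡⟨ cong (2 ℕ.+_) (∣⁅x⁆∣≡1 z) ⟩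
  3                          ∎
  where
  open ≡-Reasoning
  x∉yz : x ∉ₛ ⁅ y ⁆ ∪ ⁅ z ⁆
  x∉yz x∈ = [ x≢y ∘ x∈⁅y⁆⇒x≡y y , x≢z ∘ x∈⁅y⁆⇒x≡y z ]′ (x∈p∪q⁻ ⁅ y ⁆ _ x∈)

-- Serves twice: to put the three points of a block in cyclic order, and to number the
-- representatives of the cycles of `f` in G⁺.
record Enumeration {v} (B : Subset v) (k : ℕ) : Set where
  field
    elem      : Fin k → Fin v
    injective : Injective _≡_ _≡_ elem
    elem∈     : ∀ i → elem i ∈ₛ B
    index     : ∀ {x} → x ∈ₛ B → ∃ λ i → elem i ≡ x

enumerate : ∀ {v} (B : Subset v) → Enumeration B ∣ B ∣
enumerate [] = record
  { elem = λ () ; injective = λ { {()} } ; elem∈ = λ () ; index = λ () }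
enumerate (outside ∷ B) = record
  { elem      = suc ∘ elem
  ; injective = injective ∘ suc-injective
  ; elem∈     = there ∘ elem∈
  ; index     = λ { (there x∈) → map₂ (cong suc) (index x∈) }
  }
  where open Enumeration (enumerate B)
enumerate (inside ∷ B) = record
  { elem      = λ { zero → zero ; (suc i) → suc (elem i) }
  ; injective = λ { {zero} {zero} _ → refl
                  ; {suc _} {suc _} eq → cong suc (injective (suc-injective eq)) }
  ; elem∈     = λ { zero → here ; (suc i) → there (elem∈ i) }
  ; index     = λ { here → zero , refl
                  ; (there x∈) → suc (proj₁ (index x∈)) , cong suc (proj₂ (index x∈)) }
  }
  where open Enumeration (enumerate B)

rotate : Fin 3 → Fin 3
rotate 0F = 1F
rotate 1F = 2F
rotate 2F = 0F

rotate³ : ∀ i → rotate (rotate (rotate i)) ≡ i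
rotate³ 0F = refl
rotate³ 1F = refl
rotate³ 2F = refl

rotate-connects : ∀ {i j} → i ≢ j → rotate i ≡ j ⊎ rotate j ≡ i
rotate-connects {0F} {0F} i≢j = contradiction refl i≢j
rotate-connects {0F} {1F} i≢j = inj₁ refl
rotate-connects {0F} {2F} i≢j = inj₂ refl
rotate-connects {1F} {0F} i≢j = inj₂ refl
rotate-connects {1F} {1F} i≢j = contradiction refl i≢j
rotate-connects {1F} {2F} i≢j = inj₁ refl
rotate-connects {2F} {0F} i≢j = inj₁ refl
rotate-connects {2F} {1F} i≢j = inj₂ refl
rotate-connects {2F} {2F} i≢j = contradiction refl i≢j

rotate≢ : ∀ i → i ≢ rotate i
rotate≢ 0F ()
rotate≢ 1F ()
rotate≢ 2F ()

rotate²≢ : ∀ i → i ≢ rotate (rotate i)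
rotate²≢ 0F ()
rotate²≢ 1F ()
rotate²≢ 2F ()

rotate-exhausts : ∀ i j → j ≡ i ⊎ j ≡ rotate i ⊎ j ≡ rotate (rotate i)
rotate-exhausts 0F 0F = inj₁ refl
rotate-exhausts 0F 1F = inj₂ (inj₁ refl)
rotate-exhausts 0F 2F = inj₂ (inj₂ refl)
rotate-exhausts 1F 0F = inj₂ (inj₂ refl)
rotate-exhausts 1F 1F = inj₁ refl
rotate-exhausts 1F 2F = inj₂ (inj₁ refl)
rotate-exhausts 2F 0F = inj₂ (inj₁ refl)
rotate-exhausts 2F 1F = inj₂ (inj₂ refl)
rotate-exhausts 2F 2F = inj₁ refl

-- The resolvable Steiner triple system formed by the orbits

module System {c v} (v≡1+2c : v ≡ suc (c ℕ.+ c)) (n : Fin c → Fin v → Fin v)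
  (n³ : ∀ i x → n i (n i (n i x)) ≡ x)
  (joins : Joins n) where

  private
    walk : Fin v → ⊤ ⊎ (Fin c ⊎ Fin c) → Fin v
    walk x (inj₁ _)        = x
    walk x (inj₂ (inj₁ i)) = n i x
    walk x (inj₂ (inj₂ i)) = n i (n i x)

    walk-onto : ∀ x y → ∃ λ w → walk x w ≡ y
    walk-onto x y with x ≟ y
    ... | yes x≡y = inj₁ tt , x≡y
    ... | no x≢y with joins x≢y
    ...   | i , _ , inj₁ (nx≡y , _) = inj₂ (inj₁ i) , nx≡y
    ...   | i , _ , inj₂ (refl , _) = inj₂ (inj₂ i) , n³ i y

    abstract
      -- By `joins` the walks from `x` reach all points, and there are 1 + 2c = v of them, so
      -- distinct walks end at distinct points. This is the source of every uniqueness statement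
      -- about a single system.
      walk-injective : ∀ x → Injective _≡_ _≡_ (walk x)
      walk-injective x = onto⇒injective-↔ walk↔
        (subst (λ k → Fin v ↔ Fin k) v≡1+2c ↔-refl) (walk-onto x)
        where
        walk↔ : (⊤ ⊎ (Fin c ⊎ Fin c)) ↔ Fin (suc (c ℕ.+ c))
        walk↔ = ↔-sym (+↔⊎ {1} {c ℕ.+ c}) ↔-∘ (↔-sym 1↔⊤ ⊎-↔ ↔-sym (+↔⊎ {c} {c}))

  next≢ : ∀ i x → x ≢ n i x
  next≢ i x eq with () ← walk-injective x {inj₁ tt} {inj₂ (inj₁ i)} eq

  next²≢ : ∀ i x → x ≢ n i (n i x)
  next²≢ i x eq with () ← walk-injective x {inj₁ tt} {inj₂ (inj₂ i)} eq

  -- Both blocks describe walks of one or two steps between `x` and `y`. Equal endpoints force the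
  -- same class and the same direction, and these determine the third point.
  Block-unique : ∀ {i j x y z w} → Block (n i) x y z → Block (n j) x y w → i ≡ j × z ≡ w
  Block-unique {i} {j} {x} (inj₁ (refl , refl)) (inj₁ (nx≡y , refl))
    with refl ← walk-injective x {inj₂ (inj₁ j)} {inj₂ (inj₁ i)} nx≡y = refl , refl
  Block-unique {i} {j} {x} (inj₁ (refl , refl)) (inj₂ (ny≡x , refl))
    with () ← walk-injective x {inj₂ (inj₂ j)} {inj₂ (inj₁ i)}
      (trans (cong (n j ∘ n j) (sym ny≡x)) (n³ j _))
  Block-unique {i} {j} {x} (inj₂ (ny≡x , refl)) (inj₁ (refl , refl))
    with () ← walk-injective x {inj₂ (inj₂ i)} {inj₂ (inj₁ j)}
      (trans (cong (n i ∘ n i) (sym ny≡x)) (n³ i _))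
  Block-unique {i} {j} {x} {y} (inj₂ (refl , refl)) (inj₂ (ny≡x , refl))
    with refl ← walk-injective y {inj₂ (inj₁ j)} {inj₂ (inj₁ i)} ny≡x = refl , refl

  Block-third≢ : ∀ {i x y z} → Block (n i) x y z → x ≢ z × y ≢ z
  Block-third≢ (inj₁ (refl , refl)) = next²≢ _ _ , next≢ _ _
  Block-third≢ (inj₂ (refl , refl)) = next≢ _ _ , next²≢ _ _

  orbit : Fin c → Fin v → Subset v
  orbit i x = ⟪ x , n i x , n i (n i x) ⟫

  orbit-next : ∀ i x → orbit i x ≡ orbit i (n i x)
  orbit-next i x = trans (triple-rotate x _ _)
    (cong ⟪ n i x , n i (n i x) ,_⟫ (sym (n³ i x)))

  orbit-base : ∀ {i x y} → y ∈ₛ orbit i x → orbit i x ≡ orbit i y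
  orbit-base {i} {x} y∈ with ∈-triple⁻ y∈
  ... | inj₁ refl        = refl
  ... | inj₂ (inj₁ refl) = orbit-next i x
  ... | inj₂ (inj₂ refl) = trans (orbit-next i x) (orbit-next i (n i x))

  ∈-orbit⇒Block : ∀ {i x y} → x ≢ y → y ∈ₛ orbit i x → ∃ λ z → Block (n i) x y z
  ∈-orbit⇒Block {i} {x} x≢y y∈ with ∈-triple⁻ y∈
  ... | inj₁ refl        = contradiction refl x≢y
  ... | inj₂ (inj₁ refl) = _ , inj₁ (refl , refl)
  ... | inj₂ (inj₂ refl) = _ , inj₂ (n³ i x , refl)

  Block⇒orbit : ∀ {i x y z} → Block (n i) x y z → orbit i x ≡ ⟪ x , y , z ⟫
  Block⇒orbit (inj₁ (refl , refl)) = refl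
  Block⇒orbit {i} {x} {y} (inj₂ (refl , refl)) = trans (orbit-base {y = y} y∈) (triple-swap y x _)
    where
    y∈ : y ∈ₛ orbit i x
    y∈ = subst (_∈ₛ orbit i x) (n³ i y) (∈-triple₃ {x = x} {n i x})

  blocks : BlockSet v
  blocks B = ∃₂ λ i x → B ≡ orbit i x

  class : Fin c → BlockSet v
  class i B = ∃ λ x → B ≡ orbit i x

  blocks⇒Block : ∀ {B x y} → blocks B → x ≢ y → x ∈ₛ B → y ∈ₛ B →
    ∃₂ λ i z → Block (n i) x y z × B ≡ ⟪ x , y , z ⟫
  blocks⇒Block {x = x} {y} (i , w , refl) x≢y x∈ y∈ = i , _ , b , trans eq (Block⇒orbit b)
    where
    eq : orbit i w ≡ orbit i x
    eq = orbit-base x∈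
    b : Block (n i) x y (proj₁ (∈-orbit⇒Block x≢y (subst (y ∈ₛ_) eq y∈)))
    b = proj₂ (∈-orbit⇒Block x≢y (subst (y ∈ₛ_) eq y∈))

  -- A common block contains `x` and `n i x`, and a pair of points determines the class.
  same-class : ∀ {B i j} → class i B → class j B → i ≡ j
  same-class {i = i} {j} (x , refl) (y , eq) = proj₁ (Block-unique {x = x}
    (inj₁ (refl , refl))
    (proj₂ (∈-orbit⇒Block (next≢ i x)
      (subst (n i x ∈ₛ_) (trans eq (orbit-base (subst (x ∈ₛ_) eq (∈-triple₁ {x = x}))))
        (∈-triple₂ {x = x})))))

  isSTS : IsSTS blocks
  isSTS = record
    { block-size  = λ { (i , x , refl) → ∣triple∣ (next≢ i x) (next≢ i _) (next²≢ i x) }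
    ; pair-unique = pair-unique
    }
    where
    pair-unique : ∀ {x y} → x ≢ y → ∃! _≡_ λ B → blocks B × x ∈ₛ B × y ∈ₛ B
    pair-unique {x} {y} x≢y with i , z , b ← joins x≢y =
      orbit i x , ((i , x , refl) , ∈-triple₁ {x = x} ,
        subst (y ∈ₛ_) (sym (Block⇒orbit b)) (∈-triple₂ {x = x})) ,
      λ { ((j , w , refl) , x∈ , y∈) → unique x∈ y∈ }
      where
      unique : ∀ {j w} → x ∈ₛ orbit j w → y ∈ₛ orbit j w → orbit i x ≡ orbit j w
      unique {j} x∈ y∈
        with eq ← orbit-base {j} x∈
        with refl ← proj₁ (Block-unique b (proj₂ (∈-orbit⇒Block x≢y (subst (y ∈ₛ_) eq y∈))))
        = sym eq

  isParallelClass : ∀ i → IsParallelClass blocks (class i)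
  isParallelClass i = (λ { (x , eq) → i , x , eq }) ,
    λ x → orbit i x , ((x , refl) , ∈-triple₁ {x = x}) ,
      λ { ((y , refl) , x∈) → sym (orbit-base x∈) }

  isPartition : IsPartition class blocks
  isPartition = (λ i → proj₁ (isParallelClass i)) ,
    λ { (i , x , eq) → i , (x , eq) , same-class (x , eq) }

-- From maps of order 3 to an LKTS

⊤⊎⊤⊎Fin↔ : ∀ {n} → ((⊤ ⊎ ⊤) ⊎ Fin n) ↔ Fin (2 ℕ.+ n)
⊤⊎⊤⊎Fin↔ = ↔-sym (+↔⊎ {2}) ↔-∘
  ((↔-sym (+↔⊎ {1} {1}) ↔-∘ (↔-sym 1↔⊤ ⊎-↔ ↔-sym 1↔⊤)) ⊎-↔ ↔-refl)

-- The two equations say that v is at least 2 and odd, so that neither the truncated subtraction nor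
-- the division loses anything.
toLKTS : ∀ {v} → v ≡ 2 ℕ.+ (v ∸ 2) → v ≡ suc ((v ∸ 1) / 2 ℕ.+ (v ∸ 1) / 2) →
  KirkmanLargeSet (Fin (v ∸ 2)) (Fin ((v ∸ 1) / 2)) (Fin v) → LKTS v
toLKTS {v} v≡2+s v≡1+2c K = record
  { systems    = Sys.blocks
  ; isLSTS     = record
    { isSTS    = Sys.isSTS
    ; disjoint = λ s≢t → λ { (B∈s , B∈t) → s≢t (common B∈s B∈t) }
    }
  ; resolvable = λ s → Sys.class s , Sys.isParallelClass s , Sys.isPartition s
  }
  where
  open KirkmanLargeSet K
  module Sys s = System v≡1+2c (next s) (next³ s) (joins s)

  module _ {x y : Fin v} (x≢y : x ≢ y) where
    third : (⊤ ⊎ ⊤) ⊎ Fin (v ∸ 2) → Fin v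
    third (inj₁ (inj₁ _)) = x
    third (inj₁ (inj₂ _)) = y
    third (inj₂ s)        = proj₁ (proj₂ (joins s x≢y))

    third-onto : ∀ z → ∃ λ s → third s ≡ z
    third-onto z with x ≟ z | y ≟ z
    ... | yes x≡z | _       = inj₁ (inj₁ tt) , x≡z
    ... | no x≢z  | yes y≡z = inj₁ (inj₂ tt) , y≡z
    ... | no x≢z  | no y≢z with s , c , b ← covers x≢y y≢z x≢z =
      inj₂ s , proj₂ (Sys.Block-unique s (proj₂ (proj₂ (joins s x≢y))) b)

    -- By `covers`, the points `x`, `y` and the third points of this pair in the v - 2 systems
    -- exhaust all v points. Being equally many, they are distinct, which makes the systems
    -- disjoint.
    third-injective : Injective _≡_ _≡_ third
    third-injective = onto⇒injective-↔
      ⊤⊎⊤⊎Fin↔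
      (subst (λ k → Fin v ↔ Fin k) v≡2+s ↔-refl) third-onto

  third≡ : ∀ {s i x y z} (x≢y : x ≢ y) → Block (next s i) x y z → third x≢y (inj₂ s) ≡ z
  third≡ {s} x≢y b = proj₂ (Sys.Block-unique s (proj₂ (proj₂ (joins s x≢y))) b)

  same-system : ∀ {s t i j x y z w} → x ≢ y →
    Block (next s i) x y z → Block (next t j) x y w → ⟪ x , y , z ⟫ ≡ ⟪ x , y , w ⟫ → s ≡ t
  same-system {s} {t} x≢y b b′ eq = inj₂-injective (third-injective x≢y
    (trans (third≡ x≢y b) (trans (triple-third eq x≢z y≢z) (sym (third≡ x≢y b′)))))
    where
    x≢z = proj₁ (Sys.Block-third≢ s b)
    y≢z = proj₂ (Sys.Block-third≢ s b)

  common : ∀ {s t B} → Sys.blocks s B → Sys.blocks t B → s ≡ t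
  common {s} {t} (i , x , refl) B∈t = compare
    (Sys.blocks⇒Block t B∈t x≢y (∈-triple₁ {x = x}) (∈-triple₂ {x = x}))
    where
    x≢y = Sys.next≢ s i x
    compare : (∃₂ λ j w → Block (next t j) x (next s i x) w ×
      Sys.orbit s i x ≡ ⟪ x , next s i x , w ⟫) → s ≡ t
    compare (j , w , b , eq) = same-system x≢y (inj₁ (refl , refl)) b eq

-- From an LKTS to maps of order 3

module _ {v} {B : Subset v} (E : Enumeration B 3) where
  open Enumeration E

  successorIn : ∀ {x} → Dec (x ∈ₛ B) → Fin v
  successorIn (yes x∈)   = elem (rotate (proj₁ (index x∈)))
  successorIn {x} (no _) = x

  successorIn-elem : ∀ i (d : Dec (elem i ∈ₛ B)) → successorIn d ≡ elem (rotate i)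
  successorIn-elem i (yes x∈) = cong (elem ∘ rotate) (injective (proj₂ (index x∈)))
  successorIn-elem i (no x∉)  = contradiction (elem∈ i) x∉

  enumeration-triple : ∀ i → B ≡ ⟪ elem i , elem (rotate i) , elem (rotate (rotate i)) ⟫
  enumeration-triple i = ⊆-antisym B⊆ (triple-⊆ (elem∈ _) (elem∈ _) (elem∈ _))
    where
    B⊆ : B ⊆ₛ ⟪ elem i , elem (rotate i) , elem (rotate (rotate i)) ⟫
    B⊆ x∈ with j , refl ← index x∈ with rotate-exhausts i j
    ... | inj₁ refl        = ∈-triple₁ {x = elem i}
    ... | inj₂ (inj₁ refl) = ∈-triple₂ {x = elem i}
    ... | inj₂ (inj₂ refl) = ∈-triple₃ {x = elem i} {elem (rotate i)}

module _ {v} (B : Subset v) where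

  private
    successor′ : Dec (∣ B ∣ ≡ 3) → Fin v → Fin v
    successor′ (yes ∣B∣≡3) x = successorIn (subst (Enumeration B) ∣B∣≡3 (enumerate B)) (x ∈? B)
    successor′ (no _)      x = x

  -- The size of `B` and the membership of the point are decided rather than assumed, so the map
  -- depends on `B` alone and respects equations between blocks. The identity is only a default:
  -- `next` applies the map to a block of size 3 and a point on it.
  successor : Fin v → Fin v
  successor = successor′ (∣ B ∣ ℕ.≟ 3)

  successor-cyclic : ∣ B ∣ ≡ 3 → let open Enumeration in
    Σ[ E ∈ Enumeration B 3 ] (∀ i → successor (elem E i) ≡ elem E (rotate i))
  successor-cyclic ∣B∣≡3 with ∣ B ∣ ℕ.≟ 3
  ... | yes eq   = E , λ i → successorIn-elem E i (Enumeration.elem E i ∈? B)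
    where E = subst (Enumeration B) eq (enumerate B)
  ... | no ∣B∣≢3 = contradiction ∣B∣≡3 ∣B∣≢3

module ResolvableSystem {v} {𝓑 : BlockSet v} (sts : IsSTS 𝓑) (res : Resolvable 𝓑) where
  open IsSTS sts

  private
    𝓟         = proj₁ res
    parallel  = proj₁ (proj₂ res)
    partition = proj₂ (proj₂ res)

  next : Fin ((v ∸ 1) / 2) → Fin v → Fin v
  next c x = successor (proj₁ (proj₂ (parallel c) x)) x

  module _ {c B} (B∈ : 𝓟 c B) where
    private
      cyclic = successor-cyclic B (block-size (proj₁ (parallel c) B∈))

    enumeration : Enumeration B 3
    enumeration = proj₁ cyclic

    open Enumeration enumeration

    next-elem : ∀ i → next c (elem i) ≡ elem (rotate i)
    next-elem i = trans
      -- Uniqueness in the parallel class identifies the block chosen through `elem i` with `B`.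
      (cong (λ B → successor B (elem i)) (proj₂ (proj₂ (proj₂ (parallel c) (elem i))) (B∈ , elem∈ i)))
      (proj₂ cyclic i)

    next³-elem : ∀ i → next c (next c (next c (elem i))) ≡ elem i
    next³-elem i rewrite next-elem i | next-elem (rotate i) | next-elem (rotate (rotate i)) =
      cong elem (rotate³ i)

    Triple-elem : ∀ i → Triple (next c) (elem i) (elem (rotate i)) (elem (rotate (rotate i)))
    Triple-elem i = next-elem i , next-elem (rotate i)

  next³ : ∀ c x → next c (next c (next c x)) ≡ x
  next³ c x = subst (λ x → next c (next c (next c x)) ≡ x) (proj₂ i) (next³-elem B∈ (proj₁ i))
    where
    B∈ = proj₁ (proj₁ (proj₂ (proj₂ (parallel c) x)))
    i  = Enumeration.index (enumeration B∈) (proj₂ (proj₁ (proj₂ (proj₂ (parallel c) x))))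

  -- Keeps the block as a set in `∈𝓑` next to its cyclic form, because disjointness of the systems
  -- is a statement about sets.
  record BlockThrough (x y : Fin v) : Set where
    field
      class   : Fin ((v ∸ 1) / 2)
      third   : Fin v
      block   : Block (next class) x y third
      x≢third : x ≢ third
      y≢third : y ≢ third
      ∈𝓑      : 𝓑 ⟪ x , y , third ⟫

  blockThrough : ∀ {x y} → x ≢ y → BlockThrough x y
  blockThrough {x} {y} x≢y
    with B , (B∈𝓑 , x∈ , y∈) , _ ← pair-unique x≢y
    with c , B∈ , _ ← proj₂ partition B∈𝓑 = through (index x∈) (index y∈)
    where
    open Enumeration (enumeration B∈)
    through : (∃ λ i → elem i ≡ x) → (∃ λ j → elem j ≡ y) → BlockThrough x y
    through (i , refl) (j , refl) with rotate-connects {i} {j} (x≢y ∘ cong elem)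
    ... | inj₁ refl = record
      { block   = inj₁ (Triple-elem B∈ i)
      ; x≢third = rotate²≢ i ∘ injective
      ; y≢third = rotate≢ (rotate i) ∘ injective
      ; ∈𝓑      = subst 𝓑 (enumeration-triple (enumeration B∈) i) B∈𝓑
      }
    ... | inj₂ refl = record
      { block   = inj₂ (Triple-elem B∈ j)
      ; x≢third = rotate≢ (rotate j) ∘ injective
      ; y≢third = rotate²≢ j ∘ injective
      ; ∈𝓑      = subst 𝓑 (trans (enumeration-triple (enumeration B∈) j) (triple-swap _ _ _)) B∈𝓑
      }

fromLKTS : ∀ {v} → v ≡ 2 ℕ.+ (v ∸ 2) → LKTS v →
  KirkmanLargeSet (Fin (v ∸ 2)) (Fin ((v ∸ 1) / 2)) (Fin v)
fromLKTS {v} v≡2+s L = record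
  { next   = Sys.next
  ; next³  = Sys.next³
  ; joins  = λ s x≢y → _ , _ , block (through s x≢y)
  ; covers = covers
  }
  where
  open LKTS L
  open IsLSTS isLSTS
  module Sys s = ResolvableSystem (isSTS s) (resolvable s)
  open module Through {s x y} (b : Sys.BlockThrough s x y) = Sys.BlockThrough s b

  through : ∀ s {x y} → x ≢ y → Sys.BlockThrough s x y
  through = Sys.blockThrough

  module _ {x y : Fin v} (x≢y : x ≢ y) where
    point : (⊤ ⊎ ⊤) ⊎ Fin (v ∸ 2) → Fin v
    point (inj₁ (inj₁ _)) = x
    point (inj₁ (inj₂ _)) = y
    point (inj₂ s)        = third (through s x≢y)

    common-third : ∀ {s t} → third (through s x≢y) ≡ third (through t x≢y) → s ≡ t
    common-third {s} {t} eq with s ≟ t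
    ... | yes s≡t = s≡t
    ... | no s≢t  = contradiction
      (∈𝓑 (through s x≢y) , subst (systems t ∘ ⟪ x , y ,_⟫) (sym eq) (∈𝓑 (through t x≢y)))
      (disjoint s≢t)

    point-injective : Injective _≡_ _≡_ point
    point-injective {inj₁ (inj₁ _)} {inj₁ (inj₁ _)} eq = refl
    point-injective {inj₁ (inj₁ _)} {inj₁ (inj₂ _)} eq = contradiction eq x≢y
    point-injective {inj₁ (inj₁ _)} {inj₂ t}        eq = contradiction eq (x≢third (through t x≢y))
    point-injective {inj₁ (inj₂ _)} {inj₁ (inj₁ _)} eq = contradiction (sym eq) x≢y
    point-injective {inj₁ (inj₂ _)} {inj₁ (inj₂ _)} eq = refl
    point-injective {inj₁ (inj₂ _)} {inj₂ t}        eq = contradiction eq (y≢third (through t x≢y))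
    point-injective {inj₂ s} {inj₁ (inj₁ _)} eq = contradiction (sym eq) (x≢third (through s x≢y))
    point-injective {inj₂ s} {inj₁ (inj₂ _)} eq = contradiction (sym eq) (y≢third (through s x≢y))
    point-injective {inj₂ s} {inj₂ t}        eq = cong inj₂ (common-third eq)

    -- The counting of `third-injective` in the opposite direction: disjointness makes the v points
    -- distinct, hence they exhaust `Fin v`, and every triple is covered.
    point-onto : ∀ z → ∃ λ w → point w ≡ z
    point-onto = injective⇒onto-↔ ⊤⊎⊤⊎Fin↔
      (subst (λ k → Fin v ↔ Fin k) v≡2+s ↔-refl) point-injective

  covers : ∀ {x y z} → x ≢ y → y ≢ z → x ≢ z → ∃₂ λ s c → Block (Sys.next s c) x y z
  covers {z = z} x≢y y≢z x≢z with point-onto x≢y z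
  ... | inj₁ (inj₁ _) , x≡z = contradiction x≡z x≢z
  ... | inj₁ (inj₂ _) , y≡z = contradiction y≡z y≢z
  ... | inj₂ s , refl       = s , _ , block (through s x≢y)

-- A solver for equations in abelian groups

module AbelianSolver {G : Set} {_+_ : G → G → G} {0# : G} { -_ : G → G}
  (isAbelianGroup : IsAbelianGroup _≡_ _+_ 0# -_) where

  private
    group : AbelianGroup 0ℓ 0ℓ
    group = record { isAbelianGroup = isAbelianGroup }
  open AbelianGroup group using (monoid; commutativeSemigroup; ∙-congˡ; ∙-congʳ; identityˡ;
    identityʳ; assoc; inverseˡ; comm)
  open AbelianGroupProperties group using (∙-cancelʳ)
  open CommutativeSemigroupProperties commutativeSemigroup using (interchange)
  open MonoidMult monoid using (×-homo-+) renaming (_×_ to _·_)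

  infixl 6 _:+_ _:-_
  infix 8 :-_

  data Expr (n : ℕ) : Set where
    var  : Fin n → Expr n
    :0   : Expr n
    _:+_ : Expr n → Expr n → Expr n
    :-_  : Expr n → Expr n

  _:-_ : ∀ {n} → Expr n → Expr n → Expr n
  a :- b = a :+ :- b

  pattern v₀ = var 0F
  pattern v₁ = var 1F
  pattern v₂ = var 2F
  pattern v₃ = var 3F
  pattern v₄ = var 4F

  ⟦_⟧ : ∀ {n} → Expr n → Vec G n → G
  ⟦ var i ⟧  ρ = lookup ρ i
  ⟦ :0 ⟧     ρ = 0#
  ⟦ a :+ b ⟧ ρ = ⟦ a ⟧ ρ + ⟦ b ⟧ ρ
  ⟦ :- a ⟧   ρ = - ⟦ a ⟧ ρ

  private
    _⊞_ : ∀ {n} → Vec ℕ n → Vec ℕ n → Vec ℕ n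
    _⊞_ = zipWith ℕ._+_

    unit : ∀ {n} → Fin n → Vec ℕ n
    unit zero    = 1 ∷ replicate _ 0
    unit (suc i) = 0 ∷ unit i

  -- An expression is normalised to a formal difference of two vectors of multiplicities, which
  -- keeps all coefficients in ℕ.
  positive negative : ∀ {n} → Expr n → Vec ℕ n
  positive (var i)  = unit i
  positive :0       = replicate _ 0
  positive (a :+ b) = positive a ⊞ positive b
  positive (:- a)   = negative a
  negative (var i)  = replicate _ 0
  negative :0       = replicate _ 0
  negative (a :+ b) = negative a ⊞ negative b
  negative (:- a)   = positive a

  private
    combination : ∀ {n} → Vec ℕ n → Vec G n → G
    combination []       []      = 0#
    combination (c ∷ cs) (x ∷ ρ) = (c · x) + combination cs ρ

    combination-0 : ∀ {n} (ρ : Vec G n) → combination (replicate n 0) ρ ≡ 0#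
    combination-0 []      = refl
    combination-0 (x ∷ ρ) = trans (identityˡ _) (combination-0 ρ)

    combination-unit : ∀ {n} (ρ : Vec G n) i → combination (unit i) ρ ≡ lookup ρ i
    combination-unit (x ∷ ρ) zero    =
      trans (cong₂ _+_ (identityʳ x) (combination-0 ρ)) (identityʳ x)
    combination-unit (x ∷ ρ) (suc i) = trans (identityˡ _) (combination-unit ρ i)

    combination-⊞ : ∀ {n} (c d : Vec ℕ n) ρ →
      combination (c ⊞ d) ρ ≡ combination c ρ + combination d ρ
    combination-⊞ []       []       []      = sym (identityˡ 0#)
    combination-⊞ (m ∷ cs) (n ∷ ds) (x ∷ ρ) =
      trans (cong₂ _+_ (×-homo-+ x m n) (combination-⊞ cs ds ρ)) (interchange _ _ _ _)

    sound : ∀ {n} (a : Expr n) ρ →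
      ⟦ a ⟧ ρ + combination (negative a) ρ ≡ combination (positive a) ρ
    sound (var i) ρ = trans (cong (lookup ρ i +_) (combination-0 ρ))
      (trans (identityʳ _) (sym (combination-unit ρ i)))
    sound :0 ρ = identityˡ _
    sound (a :+ b) ρ = begin
      (⟦ a ⟧ ρ + ⟦ b ⟧ ρ) + combination (negative a ⊞ negative b) ρ
        ≡⟨ ∙-congˡ (combination-⊞ (negative a) (negative b) ρ) ⟩
      (⟦ a ⟧ ρ + ⟦ b ⟧ ρ) + (combination (negative a) ρ + combination (negative b) ρ)
        ≡⟨ interchange _ _ _ _ ⟩
      (⟦ a ⟧ ρ + combination (negative a) ρ) + (⟦ b ⟧ ρ + combination (negative b) ρ)
        ≡⟨ cong₂ _+_ (sound a ρ) (sound b ρ) ⟩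
      combination (positive a) ρ + combination (positive b) ρ
        ≡⟨ combination-⊞ (positive a) (positive b) ρ ⟨
      combination (positive a ⊞ positive b) ρ ∎
      where open ≡-Reasoning
    sound (:- a) ρ = begin
      (- ⟦ a ⟧ ρ) + combination (positive a) ρ                 ≡⟨ ∙-congˡ (sound a ρ) ⟨
      (- ⟦ a ⟧ ρ) + (⟦ a ⟧ ρ + combination (negative a) ρ)     ≡⟨ assoc _ _ _ ⟨
      ((- ⟦ a ⟧ ρ) + ⟦ a ⟧ ρ) + combination (negative a) ρ     ≡⟨ ∙-congʳ (inverseˡ _) ⟩
      0# + combination (negative a) ρ                          ≡⟨ identityˡ _ ⟩
      combination (negative a) ρ                               ∎
      where open ≡-Reasoning

  -- Formal differences are compared by cross addition, and the common summand is cancelled. For a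
  -- concrete expression the last argument is an equation of numerals that holds by computation.
  prove : ∀ {n} (a b : Expr n) (ρ : Vec G n) →
    positive a ⊞ negative b ≡ positive b ⊞ negative a → ⟦ a ⟧ ρ ≡ ⟦ b ⟧ ρ
  prove a b ρ eq = ∙-cancelʳ (combination (negative a ⊞ negative b) ρ) _ _ (begin
    ⟦ a ⟧ ρ + combination (negative a ⊞ negative b) ρ
      ≡⟨ ∙-congˡ (combination-⊞ (negative a) (negative b) ρ) ⟩
    ⟦ a ⟧ ρ + (combination (negative a) ρ + combination (negative b) ρ)
      ≡⟨ assoc _ _ _ ⟨
    (⟦ a ⟧ ρ + combination (negative a) ρ) + combination (negative b) ρ
      ≡⟨ ∙-congʳ (sound a ρ) ⟩
    combination (positive a) ρ + combination (negative b) ρ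
      ≡⟨ combination-⊞ (positive a) (negative b) ρ ⟨
    combination (positive a ⊞ negative b) ρ
      ≡⟨ cong (λ c → combination c ρ) eq ⟩
    combination (positive b ⊞ negative a) ρ
      ≡⟨ combination-⊞ (positive b) (negative a) ρ ⟩
    combination (positive b) ρ + combination (negative a) ρ
      ≡⟨ ∙-congʳ (sound b ρ) ⟨
    (⟦ b ⟧ ρ + combination (negative b) ρ) + combination (negative a) ρ
      ≡⟨ assoc _ _ _ ⟩
    ⟦ b ⟧ ρ + (combination (negative b) ρ + combination (negative a) ρ)
      ≡⟨ ∙-congˡ (comm _ _) ⟩
    ⟦ b ⟧ ρ + (combination (negative a) ρ + combination (negative b) ρ)
      ≡⟨ ∙-congˡ (combination-⊞ (negative a) (negative b) ρ) ⟨
    ⟦ b ⟧ ρ + combination (negative a ⊞ negative b) ρ ∎)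
    where open ≡-Reasoning

-- Exponents modulo 3 and the action of the six units

infixl 6 _⊹_

_⊹_ : Fin 3 → Fin 3 → Fin 3
0F ⊹ j = j
1F ⊹ j = rotate j
2F ⊹ j = rotate (rotate j)

⊟_ : Fin 3 → Fin 3
⊟ 0F = 0F
⊟ 1F = 2F
⊟ 2F = 1F

⊟-cancel : ∀ {i j} → ⊟ j ⊹ i ≡ 0F → i ≡ j
⊟-cancel {0F} {0F} _ = refl
⊟-cancel {0F} {1F} ()
⊟-cancel {0F} {2F} ()
⊟-cancel {1F} {0F} ()
⊟-cancel {1F} {1F} _ = refl
⊟-cancel {1F} {2F} ()
⊟-cancel {2F} {0F} ()
⊟-cancel {2F} {1F} ()
⊟-cancel {2F} {2F} _ = refl

⊟-inverse : ∀ i → ⊟ i ⊹ i ≡ 0F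
⊟-inverse 0F = refl
⊟-inverse 1F = refl
⊟-inverse 2F = refl

⊟-inverseʳ : ∀ i → i ⊹ ⊟ i ≡ 0F
⊟-inverseʳ 0F = refl
⊟-inverseʳ 1F = refl
⊟-inverseʳ 2F = refl

-- (σ , t) stands for the sixth root of unity σ ω^t, where ω acts on the group G as f and on ℤ/7 as 2.
Unit : Set
Unit = Sign × Fin 3

module Action {G : Set} (-_ f : G → G) where
  f^ : Fin 3 → G → G
  f^ 0F a = a
  f^ 1F a = f a
  f^ 2F a = f (f a)

  act : Unit → G → G
  act (⁺ , t) a = f^ t a
  act (⁻ , t) a = - f^ t a

  module Placement {r} (rep : Fin r → G) (0# : G) where
    -- When `rep` meets each orbit of the six units on G∖{0} once, these are names for the elements
    -- of G.
    place : Maybe (Unit × Fin r) → G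
    place nothing        = 0#
    place (just (ζ , y)) = act ζ (rep y)

  module _ (f³ : ∀ a → f (f (f a)) ≡ a) where
    f-f^ : ∀ t a → f (f^ t a) ≡ f^ (rotate t) a
    f-f^ 0F a = refl
    f-f^ 1F a = refl
    f-f^ 2F a = f³ a

    f^-⊹ : ∀ s t a → f^ s (f^ t a) ≡ f^ (s ⊹ t) a
    f^-⊹ 0F t a = refl
    f^-⊹ 1F t a = f-f^ t a
    f^-⊹ 2F t a = trans (cong f (f-f^ t a)) (f-f^ (rotate t) a)

-- The properties of a cubic orthomorphism that the construction uses, with the surjectivity halves
-- of the bijections only.
record DiscreteOrthomorphism (G : Set) (r : ℕ) : Set where
  infixl 6 _+_ _-_
  infix 8 -_
  field
    _+_  : G → G → G
    0#   : G
    -_   : G → G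
    isAbelianGroup : IsAbelianGroup _≡_ _+_ 0# -_
    f    : G → G

  open Action -_ f public

  _-_ : G → G → G
  a - b = a + (- b)

  -- Division by 3 locates the translate that contains a given triple with residues of triangle
  -- type.
  Trisectible : Set
  Trisectible = ∀ a → ∃ λ x → (x + x) + x ≡ a

  field
    f-zero        : f 0# ≡ 0#
    f³            : ∀ a → f (f (f a)) ≡ a
    odd           : ∀ a → f (- a) ≡ - f a
    sum-zero      : ∀ a → (a + f a) + f (f a) ≡ 0#
    orthomorphism : ∀ d → ∃ λ a → f a - a ≡ d
    shift         : ∀ b c → ∃ λ a → f (f a) + f (b - a) ≡ c
    rep           : Fin r → G

  G⁺ : Pred G 0ℓ
  G⁺ a = ∃₂ λ t y → a ≡ f^ t (rep y)

  field
    difference    : ∀ b {c} → c ≢ 0# →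
      ∃ λ a → G⁺ a × ((a + f b) - f (a + b) ≡ c ⊎ (f (f a) + f b) - f (a + b) ≡ c)

  open Placement rep 0# public

  field
    coord       : G → Maybe (Unit × Fin r)
    place-coord : ∀ a → place (coord a) ≡ a
    coord-place : ∀ w → coord (place w) ≡ w

  place↔ : Maybe (Unit × Fin r) ↔ G
  place↔ = mk↔ₛ′ place coord place-coord coord-place

-- Transport of the cubic orthomorphism to `Fin q`, and representatives of its cycles

module Selection {n} {P : Pred (Fin n) 0ℓ} (P? : Decidable P) where
  selection : Subset n
  selection = tabulate (does ∘ P?)

  ∈-selection⁺ : ∀ {x} → P x → x ∈ₛ selection
  ∈-selection⁺ {x} p = lookup⇒[]= x selection
    (trans (lookup∘tabulate (does ∘ P?) x) (dec-true (P? x) p))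

  ∈-selection⁻ : ∀ {x} → x ∈ₛ selection → P x
  ∈-selection⁻ {x} x∈ with P? x | trans (sym (lookup∘tabulate (does ∘ P?) x)) ([]=⇒lookup x∈)
  ... | yes p | _ = p
  ... | no ¬p | ()

module Discretise {q} (C : CubicOrthomorphism q) where
  open CubicOrthomorphism C renaming (f to φ; odd to φ-odd)
  module G = AbelianGroup G
  open Inverse order using (to; from; to-cong; strictlyInverseˡ; strictlyInverseʳ)

  φ-cong : ∀ {x y} → x ≈ y → φ x ≈ φ y
  φ-cong = IsBijection.cong f-permutation

  infixl 6 _+′_
  _+′_ : Fin q → Fin q → Fin q
  x +′ y = to (from x + from y)

  -′_ f : Fin q → Fin q
  -′ x = to (- from x)
  f x = to (φ (from x))

  0′ : Fin q
  0′ = to 0#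

  from-injective : ∀ {x y} → from x ≈ from y → x ≡ y
  from-injective {x} {y} eq =
    trans (sym (strictlyInverseˡ x)) (trans (to-cong eq) (strictlyInverseˡ y))

  from-+ : ∀ x y → from (x +′ y) ≈ from x + from y
  from-+ x y = strictlyInverseʳ _

  from-neg : ∀ x → from (-′ x) ≈ - from x
  from-neg x = strictlyInverseʳ _

  from-f : ∀ x → from (f x) ≈ φ (from x)
  from-f x = strictlyInverseʳ _

  from-cong : ∀ {x y} → x ≡ y → from x ≈ from y
  from-cong refl = G.refl

  isAbelianGroup : IsAbelianGroup _≡_ _+′_ 0′ -′_
  isAbelianGroup = GroupMonomorphism.isAbelianGroup mono G.isAbelianGroup
    where
    mono : IsGroupMonomorphism
      (record { Carrier = Fin q ; _≈_ = _≡_ ; _∙_ = _+′_ ; ε = 0′ ; _⁻¹ = -′_ }) G.rawGroup from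
    mono = record
      { isGroupHomomorphism = record
        { isMonoidHomomorphism = record
          { isMagmaHomomorphism = record
            { isRelHomomorphism = record { cong = from-cong }
            ; homo = from-+ }
          ; ε-homo = strictlyInverseʳ 0# }
        ; ⁻¹-homo = from-neg }
      ; injective = from-injective }

  open Action -′_ f
  open SetoidReasoning G-setoid

  from-f² : ∀ x → from (f (f x)) ≈ φ (φ (from x))
  from-f² x = G.trans (from-f (f x)) (φ-cong (from-f x))

  φ-zero : φ 0# ≈ 0#
  φ-zero = proj₁ (proj₂ cycle-zero)

  f-zero : f 0′ ≡ 0′
  f-zero = from-injective (begin
    from (f 0′)        ≈⟨ from-f 0′ ⟩
    φ (from 0′)        ≈⟨ φ-cong (strictlyInverseʳ 0#) ⟩
    φ 0#               ≈⟨ φ-zero ⟩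
    0#                 ≈⟨ strictlyInverseʳ 0# ⟨
    from 0′            ∎)

  φ-φ-φ : ∀ x → φ (φ (φ x)) ≈ x
  -- The partition of G separates 0 from the 3-cycles: on G⁺ and -G⁺ the uniqueness of the part
  -- gives `x ≉ 0#`.
  φ-φ-φ x with proj₂ G⁺-partition {x} tt
  ... | 0F , x≈0 , _ = G.trans (φ-cong (φ-cong (φ-cong x≈0)))
    (G.trans (φ-cong (φ-cong φ-zero)) (G.trans (φ-cong φ-zero) (G.trans φ-zero (G.sym x≈0))))
  ... | 1F , x∈ , u  = proj₁ (proj₂ (cycle-nonzero λ x≈0 → contradiction (u {0F} x≈0) λ ()))
  ... | 2F , x∈ , u  = proj₁ (proj₂ (cycle-nonzero λ x≈0 → contradiction (u {0F} x≈0) λ ()))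

  f³ : ∀ x → f (f (f x)) ≡ x
  f³ x = from-injective (begin
    from (f (f (f x)))     ≈⟨ from-f² (f x) ⟩
    φ (φ (from (f x)))     ≈⟨ φ-cong (φ-cong (from-f x)) ⟩
    φ (φ (φ (from x)))     ≈⟨ φ-φ-φ (from x) ⟩
    from x                 ∎)

  odd : ∀ x → f (-′ x) ≡ -′ f x
  odd x = from-injective (begin
    from (f (-′ x))        ≈⟨ from-f (-′ x) ⟩
    φ (from (-′ x))        ≈⟨ φ-cong (from-neg x) ⟩
    φ (- from x)           ≈⟨ φ-odd (from x) ⟩
    - φ (from x)           ≈⟨ G.⁻¹-cong (from-f x) ⟨
    - from (f x)           ≈⟨ from-neg (f x) ⟨
    from (-′ f x)          ∎)

  sum-zero′ : ∀ x → x +′ f x +′ f (f x) ≡ 0′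
  sum-zero′ x = from-injective (begin
    from (x +′ f x +′ f (f x))                  ≈⟨ from-+ _ _ ⟩
    from (x +′ f x) + from (f (f x))            ≈⟨ G.∙-cong (from-+ _ _) (from-f² x) ⟩
    (from x + from (f x)) + φ (φ (from x))      ≈⟨ G.∙-congʳ (G.∙-congˡ (from-f x)) ⟩
    (from x + φ (from x)) + φ (φ (from x))      ≈⟨ sum-zero (from x) ⟩
    0#                                          ≈⟨ strictlyInverseʳ 0# ⟨
    from 0′                                     ∎)

  orthomorphism′ : ∀ d → ∃ λ a → f a +′ -′ a ≡ d
  orthomorphism′ d with a , h ← IsBijection.surjective orthomorphism (from d) =
    to a , from-injective (begin
      from (f (to a) +′ -′ to a)          ≈⟨ from-+ _ _ ⟩
      from (f (to a)) + from (-′ to a)    ≈⟨ G.∙-cong (from-f _) (from-neg _) ⟩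
      φ (from (to a)) - from (to a)       ≈⟨ h (strictlyInverseʳ a) ⟩
      from d                              ∎)

  shift′ : ∀ b c → ∃ λ a → f (f a) +′ f (b +′ -′ a) ≡ c
  shift′ b c with a , h ← IsBijection.surjective (shift-permutation (from b)) (from c) =
    to a , from-injective (begin
      from (f (f (to a)) +′ f (b +′ -′ to a))
        ≈⟨ from-+ _ _ ⟩
      from (f (f (to a))) + from (f (b +′ -′ to a))
        ≈⟨ G.∙-cong (from-f² _) (from-f _) ⟩
      φ (φ (from (to a))) + φ (from (b +′ -′ to a))
        ≈⟨ G.∙-congˡ (φ-cong (G.trans (from-+ _ _) (G.∙-congˡ (from-neg _)))) ⟩
      φ (φ (from (to a))) + φ (from b - from (to a))
        ≈⟨ h (strictlyInverseʳ a) ⟩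
      from c ∎)

  Positive : Pred (Fin q) 0ℓ
  Positive x = G⁺ (from x)

  data SignView (x : Fin q) : Set where
    is-zero     : x ≡ 0′ → SignView x
    is-positive : Positive x → SignView x
    is-negative : Positive (-′ x) → SignView x

  signView : ∀ x → SignView x
  signView x with proj₂ G⁺-partition {from x} tt
  ... | 0F , x≈0 , _ = is-zero (from-injective (G.trans x≈0 (G.sym (strictlyInverseʳ 0#))))
  ... | 1F , x∈ , _ = is-positive x∈
  ... | 2F , (z , z∈ , -z≈x) , _ = is-negative (G⁺-resp-≈ z≈ z∈)
    where
    z≈ : z ≈ from (-′ x)
    z≈ = begin
      z                ≈⟨ AbelianGroupProperties.⁻¹-involutive G z ⟨
      - (- z)          ≈⟨ G.⁻¹-cong -z≈x ⟩
      - from x         ≈⟨ from-neg x ⟨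
      from (-′ x)      ∎

  positive≢0 : ∀ {x} → Positive x → x ≢ 0′
  positive≢0 {x} x∈ refl with proj₂ G⁺-partition {from x} tt
  ... | i , _ , u with () ← trans (sym (u {1F} x∈)) (u {0F} (strictlyInverseʳ 0#))

  ¬positive-negative : ∀ {x} → Positive x → ¬ Positive (-′ x)
  ¬positive-negative {x} x∈ -x∈ with proj₂ G⁺-partition {from x} tt
  ... | i , _ , u with () ← trans (sym (u {1F} x∈))
    (u {2F} (from (-′ x) , -x∈ , G.trans (G.⁻¹-cong (from-neg x))
      (AbelianGroupProperties.⁻¹-involutive G _)))

  positive? : Decidable Positive
  positive? x with signView x
  ... | is-zero x≡0      = no λ x∈ → positive≢0 x∈ x≡0
  ... | is-positive x∈   = yes x∈
  ... | is-negative -x∈  = no λ x∈ → ¬positive-negative x∈ -x∈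

  positive-f : ∀ {x} → Positive x → Positive (f x)
  positive-f {x} x∈ = proj₁ f-G⁺ (from x , x∈ , G.sym (from-f x))

  positive-f^ : ∀ t {x} → Positive x → Positive (f^ t x)
  positive-f^ 0F = λ x∈ → x∈
  positive-f^ 1F = positive-f
  positive-f^ 2F = positive-f ∘ positive-f

  f≢ : ∀ {x} → Positive x → f x ≢ x
  f≢ {x} x∈ fx≡x = proj₂ (proj₂ (cycle-nonzero {from x}
      (λ x≈0 → positive≢0 x∈ (from-injective (G.trans x≈0 (G.sym (strictlyInverseʳ 0#)))))))
    {1} (ℕ.s≤s ℕ.z≤n) (ℕ.s≤s (ℕ.s≤s ℕ.z≤n))
    (G.trans (G.sym (from-f x)) (from-cong fx≡x))

  -- The element of least index represents its cycle in G⁺. This choice is decidable, so the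
  -- representatives can be enumerated.
  Least : Pred (Fin q) 0ℓ
  Least x = Positive x × toℕ x ℕ.≤ toℕ (f x) × toℕ x ℕ.≤ toℕ (f (f x))

  least? : Decidable Least
  least? x = positive? x ×-dec (toℕ x ℕ.≤? toℕ (f x)) ×-dec (toℕ x ℕ.≤? toℕ (f (f x)))

  least-in-cycle : ∀ {x} → Positive x → ∃₂ λ t y → Least y × f^ t y ≡ x
  least-in-cycle {x} x∈
    with ℕ.≤-total (toℕ x) (toℕ (f x)) | ℕ.≤-total (toℕ x) (toℕ (f (f x)))
       | ℕ.≤-total (toℕ (f x)) (toℕ (f (f x)))
  ... | inj₁ x≤fx | inj₁ x≤f²x | _ = 0F , x , (x∈ , x≤fx , x≤f²x) , refl
  ... | inj₁ x≤fx | inj₂ f²x≤x | _ = 1F , f (f x) , (positive-f^ 2F x∈ ,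
    subst (λ z → toℕ (f (f x)) ℕ.≤ toℕ z) (sym (f³ x)) f²x≤x ,
    subst (λ z → toℕ (f (f x)) ℕ.≤ toℕ (f z)) (sym (f³ x)) (ℕ.≤-trans f²x≤x x≤fx)) , f³ x
  ... | inj₂ fx≤x | _ | inj₁ fx≤f²x = 2F , f x , (positive-f x∈ , fx≤f²x ,
    subst (λ z → toℕ (f x) ℕ.≤ toℕ z) (sym (f³ x)) fx≤x) , f³ x
  ... | inj₂ fx≤x | _ | inj₂ f²x≤fx = 1F , f (f x) , (positive-f^ 2F x∈ ,
    subst (λ z → toℕ (f (f x)) ℕ.≤ toℕ z) (sym (f³ x)) (ℕ.≤-trans f²x≤fx fx≤x) ,
    subst (λ z → toℕ (f (f x)) ℕ.≤ toℕ (f z)) (sym (f³ x)) f²x≤fx) , f³ x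

  -- Two least elements of one cycle have equal indices, hence coincide. A nonzero exponent would
  -- then give a fixed point of `f` in G⁺.
  least-shift : ∀ {y z} → Least y → Least z → ∀ t → f^ t y ≡ z → t ≡ 0F
  least-shift _ _ 0F _ = refl
  least-shift {y} (y∈ , y≤fy , _) (_ , _ , fy≤y) 1F refl = contradiction
    (toℕ-injective (ℕ.≤-antisym (subst (λ z → toℕ (f y) ℕ.≤ toℕ z) (f³ y) fy≤y) y≤fy)) (f≢ y∈)
  least-shift {y} (y∈ , _ , y≤f²y) (_ , f²y≤y , _) 2F refl = contradiction
    (trans (cong f (sym y≡f²y)) (f³ y)) (f≢ y∈)
    where
    y≡f²y : f (f y) ≡ y
    y≡f²y = toℕ-injective
      (ℕ.≤-antisym (subst (λ z → toℕ (f (f y)) ℕ.≤ toℕ z) (f³ y) f²y≤y) y≤f²y)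

  -- Applying `f^ (⊟ t)` to both sides leaves a single exponent, to which `least-shift` applies.
  least-unique : ∀ {y z} → Least y → Least z → ∀ s t → f^ s y ≡ f^ t z → s ≡ t × y ≡ z
  least-unique {y} {z} y-least z-least s t eq = ⊟-cancel s-t≡0 ,
    trans (cong (λ k → f^ k y) (sym s-t≡0)) shifted
    where
    shifted : f^ (⊟ t ⊹ s) y ≡ z
    shifted = trans (sym (f^-⊹ f³ (⊟ t) s y)) (trans (cong (f^ (⊟ t)) eq)
      (trans (f^-⊹ f³ (⊟ t) t z) (cong (λ k → f^ k z) (⊟-inverse t))))
    s-t≡0 : ⊟ t ⊹ s ≡ 0F
    s-t≡0 = least-shift y-least z-least (⊟ t ⊹ s) shifted

  open Selection least?

  -- The number of cycles of `f` in G⁺, which is (q - 1)/6 by `q≡1+6r`.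
  r : ℕ
  r = ∣ selection ∣

  open Enumeration (enumerate selection) renaming (elem to rep; injective to rep-injective)

  rep-least : ∀ y → Least (rep y)
  rep-least y = ∈-selection⁻ (elem∈ y)

  positive-coord : ∀ {x} → Positive x → ∃₂ λ t y → x ≡ f^ t (rep y)
  positive-coord x∈ with t , y , y-least , refl ← least-in-cycle x∈
    with i , refl ← index (∈-selection⁺ y-least) = t , i , refl

  rep-unique : ∀ s t {y z} → f^ s (rep y) ≡ f^ t (rep z) → (s , y) ≡ (t , z)
  rep-unique s t {y} {z} eq with least-unique (rep-least y) (rep-least z) s t eq
  ... | refl , y≡z = cong (s ,_) (rep-injective y≡z)

  rep-positive : ∀ t y → Positive (f^ t (rep y))
  rep-positive t y = positive-f^ t (proj₁ (rep-least y))

  private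
    group : AbelianGroup 0ℓ 0ℓ
    group = record { isAbelianGroup = isAbelianGroup }
  open AbelianGroupProperties group using (⁻¹-involutive; ⁻¹-injective; ε⁻¹≈ε)

  difference′ : ∀ b {c} → c ≢ 0′ → ∃ λ a → (∃₂ λ t y → a ≡ f^ t (rep y)) ×
    ((a +′ f b) +′ -′ f (a +′ b) ≡ c ⊎ (f (f a) +′ f b) +′ -′ f (a +′ b) ≡ c)
  difference′ b {c} c≢0
    with proj₂ (difference-partition (from b)) {from c}
      (λ c≈0 → c≢0 (from-injective (G.trans c≈0 (G.sym (strictlyInverseʳ 0#)))))
  ... | 0F , (a , a∈ , eq) , _ = to a , positive-coord (G⁺-resp-≈ (G.sym (strictlyInverseʳ a)) a∈) ,
    inj₁ (from-injective (begin
      from ((to a +′ f b) +′ -′ f (to a +′ b))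
        ≈⟨ from-+ _ _ ⟩
      from (to a +′ f b) + from (-′ f (to a +′ b))
        ≈⟨ G.∙-cong (from-+ _ _) (from-neg _) ⟩
      (from (to a) + from (f b)) - from (f (to a +′ b))
        ≈⟨ G.∙-cong (G.∙-cong (strictlyInverseʳ a) (from-f b)) (G.⁻¹-cong (from-f _)) ⟩
      (a + φ (from b)) - φ (from (to a +′ b))
        ≈⟨ G.∙-congˡ (G.⁻¹-cong (φ-cong (G.trans (from-+ _ _) (G.∙-congʳ (strictlyInverseʳ a))))) ⟩
      (a + φ (from b)) - φ (a + from b)
        ≈⟨ eq ⟩
      from c ∎))
  ... | 1F , (a , a∈ , eq) , _ = to a , positive-coord (G⁺-resp-≈ (G.sym (strictlyInverseʳ a)) a∈) ,
    inj₂ (from-injective (begin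
      from ((f (f (to a)) +′ f b) +′ -′ f (to a +′ b))
        ≈⟨ from-+ _ _ ⟩
      from (f (f (to a)) +′ f b) + from (-′ f (to a +′ b))
        ≈⟨ G.∙-cong (from-+ _ _) (from-neg _) ⟩
      (from (f (f (to a))) + from (f b)) - from (f (to a +′ b))
        ≈⟨ G.∙-cong (G.∙-cong (from-f² _) (from-f b)) (G.⁻¹-cong (from-f _)) ⟩
      (φ (φ (from (to a))) + φ (from b)) - φ (from (to a +′ b))
        ≈⟨ G.∙-cong (G.∙-congʳ (φ-cong (φ-cong (strictlyInverseʳ a))))
            (G.⁻¹-cong (φ-cong (G.trans (from-+ _ _) (G.∙-congʳ (strictlyInverseʳ a))))) ⟩
      (φ (φ a) + φ (from b)) - φ (a + from b)
        ≈⟨ eq ⟩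
      from c ∎))

  open Placement rep 0′

  place-onto : ∀ x → ∃ λ w → place w ≡ x
  place-onto x with signView x
  ... | is-zero x≡0    = nothing , sym x≡0
  ... | is-positive x∈ with t , y , eq ← positive-coord x∈ = just ((⁺ , t) , y) , sym eq
  ... | is-negative -x∈ with t , y , eq ← positive-coord -x∈ =
    just ((⁻ , t) , y) , trans (cong -′_ (sym eq)) (⁻¹-involutive x)

  -- The sets {0}, G⁺ and -G⁺ are disjoint, and an element of G⁺ determines its representative and
  -- exponent.
  place-injective : Injective _≡_ _≡_ place
  place-injective {nothing} {nothing} _ = refl
  place-injective {nothing} {just ((⁺ , t) , y)} eq =
    contradiction (sym eq) (positive≢0 (rep-positive t y))
  place-injective {nothing} {just ((⁻ , t) , y)} eq =
    contradiction (⁻¹-injective (trans (sym eq) (sym ε⁻¹≈ε))) (positive≢0 (rep-positive t y))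
  place-injective {just ((⁺ , t) , y)} {nothing} eq =
    contradiction eq (positive≢0 (rep-positive t y))
  place-injective {just ((⁻ , t) , y)} {nothing} eq =
    contradiction (⁻¹-injective (trans eq (sym ε⁻¹≈ε))) (positive≢0 (rep-positive t y))
  place-injective {just ((⁺ , s) , y)} {just ((⁺ , t) , z)} eq with refl ← rep-unique s t eq = refl
  place-injective {just ((⁺ , s) , y)} {just ((⁻ , t) , z)} eq =
    contradiction (subst Positive eq (rep-positive s y)) λ -z∈ →
      ¬positive-negative (rep-positive t z) -z∈
  place-injective {just ((⁻ , s) , y)} {just ((⁺ , t) , z)} eq =
    contradiction (subst Positive (sym eq) (rep-positive t z)) λ -y∈ →
      ¬positive-negative (rep-positive s y) -y∈
  place-injective {just ((⁻ , s) , y)} {just ((⁻ , t) , z)} eq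
    with refl ← rep-unique s t (⁻¹-injective eq) = refl

  place-coord : ∀ x → place (proj₁ (place-onto x)) ≡ x
  place-coord x = proj₂ (place-onto x)

  discrete : DiscreteOrthomorphism (Fin q) r
  discrete = record
    { isAbelianGroup = isAbelianGroup
    ; f              = f
    ; f-zero         = f-zero
    ; f³             = f³
    ; odd            = odd
    ; sum-zero       = sum-zero′
    ; orthomorphism  = orthomorphism′
    ; shift          = shift′
    ; rep            = rep
    ; difference     = difference′
    ; coord          = proj₁ ∘ place-onto
    ; place-coord    = place-coord
    ; coord-place    = λ w → place-injective (place-coord (place w))
    }

-- Residues modulo 7

triple? : ∀ {V : Set} → DecidableEquality V → (n : V → V) → ∀ x y z → Dec (Triple n x y z)
triple? _≟_ n x y z = map′ (λ (p , q) → p , q) (λ (p , q) → p , q) ((n x ≟ y) ×-dec (n y ≟ z))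

-- Statements about residues, units and exponents concern finitely many cases and are proved by
-- evaluating a decision procedure.
decide : ∀ {a} {A : Set a} (A? : Dec A) {_ : True A?} → A
decide _ {t} = toWitness t

allSign? : ∀ {p} {P : Pred Sign p} → Decidable P → Dec (∀ σ → P σ)
allSign? P? = map′ (λ { (p , q) ⁺ → p ; (p , q) ⁻ → q }) (λ h → h ⁺ , h ⁻) (P? ⁺ ×-dec P? ⁻)

allUnit? : ∀ {p} {P : Pred Unit p} → Decidable P → Dec (∀ ζ → P ζ)
allUnit? P? = map′ (λ { h (σ , t) → h σ t }) (λ h σ t → h (σ , t))
  (allSign? λ σ → all? λ t → P? (σ , t))

-- The unit (σ , e) is the residue σ 2^e.
Z₇ : Set
Z₇ = Maybe Unit

allZ₇? : ∀ {p} {P : Pred Z₇ p} → Decidable P → Dec (∀ i → P i)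
allZ₇? P? = map′ (λ { (p , h) nothing → p ; (p , h) (just ζ) → h ζ })
  (λ h → h nothing , h ∘ just) (P? nothing ×-dec allUnit? (P? ∘ just))

_≟ᵤ_ : DecidableEquality Unit
_≟ᵤ_ = ≡-dec Sign._≟_ Fin._≟_

_≟₇_ : DecidableEquality Z₇
_≟₇_ = Maybe.≡-dec _≟ᵤ_

residue : Z₇ → ℕ
residue nothing         = 0
residue (just (⁺ , 0F)) = 1
residue (just (⁺ , 1F)) = 2
residue (just (⁺ , 2F)) = 4
residue (just (⁻ , 0F)) = 6
residue (just (⁻ , 1F)) = 5
residue (just (⁻ , 2F)) = 3

mod₇ : ℕ → Z₇
mod₇ 0 = nothing
mod₇ 1 = just (⁺ , 0F)
mod₇ 2 = just (⁺ , 1F)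
mod₇ 3 = just (⁻ , 2F)
mod₇ 4 = just (⁺ , 2F)
mod₇ 5 = just (⁻ , 1F)
mod₇ 6 = just (⁻ , 0F)
mod₇ (suc (suc (suc (suc (suc (suc (suc n))))))) = mod₇ n

infixl 6 _+₇_ _-₇_

_+₇_ : Z₇ → Z₇ → Z₇
i +₇ j = mod₇ (residue i ℕ.+ residue j)

_-₇_ : Z₇ → Z₇ → Z₇
i -₇ j = mod₇ (residue i ℕ.+ (7 ℕ.∸ residue j))

abstract
  -₇-+₇ : ∀ i m → i -₇ m +₇ m ≡ i
  -₇-+₇ = decide (allZ₇? λ i → allZ₇? λ m → (i -₇ m +₇ m) ≟₇ i)

  +₇--₇ : ∀ i m → i +₇ m -₇ m ≡ i
  +₇--₇ = decide (allZ₇? λ i → allZ₇? λ m → (i +₇ m -₇ m) ≟₇ i)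

  i-₇i : ∀ i → i -₇ i ≡ nothing
  i-₇i = decide (allZ₇? λ i → (i -₇ i) ≟₇ nothing)

  -₇≡nothing : ∀ i m → i -₇ m ≡ nothing → i ≡ m
  -₇≡nothing i m eq = trans (sym (-₇-+₇ i m)) (trans (cong (_+₇ m) eq) (nothing-+₇ m))
    where
    nothing-+₇ : ∀ m → nothing +₇ m ≡ m
    nothing-+₇ = decide (allZ₇? λ m → (nothing +₇ m) ≟₇ m)

  -₇-injective : ∀ i j m → i -₇ m ≡ j -₇ m → i ≡ j
  -₇-injective i j m eq = trans (sym (-₇-+₇ i m)) (trans (cong (_+₇ m) eq) (-₇-+₇ j m))

-- The affine plane of order 3 and the frames around a line

data Ext (A : Set) : Set where
  ∞  : Bool → Ext A
  pt : A → Ext A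

pt-injective : ∀ {A} {a b : A} → pt a ≡ pt b → a ≡ b
pt-injective refl = refl

mapExt : ∀ {A B} → (A → B) → Ext A → Ext B
mapExt f (∞ b)  = ∞ b
mapExt f (pt a) = pt (f a)

Ext-↔ : ∀ {A B} → A ↔ B → Ext A ↔ Ext B
Ext-↔ e = mk↔ₛ′ (mapExt to) (mapExt from)
  (λ { (∞ b) → refl ; (pt b) → cong pt (strictlyInverseˡ b) })
  (λ { (∞ b) → refl ; (pt a) → cong pt (strictlyInverseʳ a) })
  where open Inverse e

-- The class of the affine plane of order 3 containing {0, 2^k, -2^k}.
line-step : Fin 3 → Ext Z₇ → Ext Z₇
line-step k (∞ false)           = pt (just (⁺ , rotate k))
line-step k (∞ true)            = pt (just (⁺ , rotate (rotate k)))
line-step k (pt nothing)        = pt (just (⁺ , k))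
line-step k (pt (just (σ , e))) = go σ (⊟ k ⊹ e)
  where
  go : Sign → Fin 3 → Ext Z₇
  go ⁺ 0F = pt (just (⁻ , e))
  go ⁺ 1F = pt (just (⁻ , rotate e))
  go ⁺ 2F = pt (just (⁻ , rotate (rotate e)))
  go ⁻ 0F = pt nothing
  go ⁻ 1F = ∞ true
  go ⁻ 2F = ∞ false

-- A pair (i , ζ) is the point with residue i at offset ζ y from the line, where y is fixed. After
-- normalising exponents by ω, the position τ = t + e - k decides the block. The offsets of residue i
-- are used by an antipodal block twice, by a double block with residues i, i, -2i twice, by the double
-- block with residues 3i, 3i, i once and by a triangle block once.
frame-step : Fin 3 → Z₇ × Unit → Z₇ × Unit
frame-step k (nothing , ⁺ , t) = just (⁺ , ⊟ t ⊹ rotate k) , ⁻ , rotate t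
frame-step k (nothing , ⁻ , t) = just (⁺ , ⊟ t ⊹ k) , ⁺ , rotate t
frame-step k (just (σ , e) , ς , t) = go σ ς (⊟ k ⊹ (t ⊹ e))
  where
  go : Sign → Sign → Fin 3 → Z₇ × Unit
  go ⁺ ⁺ 0F = just (⁺ , rotate e) , ⁺ , rotate (rotate t)
  go ⁺ ⁺ 1F = just (⁻ , e) , ⁺ , rotate t
  go ⁺ ⁺ 2F = just (⁻ , rotate (rotate e)) , ⁻ , t
  go ⁺ ⁻ 0F = just (⁺ , e) , ⁻ , rotate t
  go ⁺ ⁻ 1F = just (⁻ , rotate e) , ⁺ , rotate (rotate t)
  go ⁺ ⁻ 2F = just (⁻ , e) , ⁻ , rotate t
  go ⁻ ⁺ 0F = just (⁻ , rotate e) , ⁺ , rotate (rotate t)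
  go ⁻ ⁺ 1F = just (⁺ , rotate (rotate e)) , ⁻ , t
  go ⁻ ⁺ 2F = nothing , ⁻ , rotate t
  go ⁻ ⁻ 0F = nothing , ⁺ , rotate t
  go ⁻ ⁻ 1F = just (⁻ , e) , ⁻ , rotate t
  go ⁻ ⁻ 2F = just (⁺ , rotate e) , ⁺ , rotate (rotate t)

_≟ₑ_ : DecidableEquality (Ext Z₇)
∞ b  ≟ₑ ∞ c  = map′ (cong ∞) (λ { refl → refl }) (b Bool.≟ c)
∞ b  ≟ₑ pt i = no λ ()
pt i ≟ₑ ∞ b  = no λ ()
pt i ≟ₑ pt j = map′ (cong pt) pt-injective (i ≟₇ j)

_≟ₓ_ : DecidableEquality (Z₇ × Unit)
_≟ₓ_ = ≡-dec _≟₇_ _≟ᵤ_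

line-step³ : ∀ k x → line-step k (line-step k (line-step k x)) ≡ x
line-step³ 0F (∞ false) = refl
line-step³ 1F (∞ false) = refl
line-step³ 2F (∞ false) = refl
line-step³ 0F (∞ true) = refl
line-step³ 1F (∞ true) = refl
line-step³ 2F (∞ true) = refl
line-step³ k (pt i) =
  decide (all? λ k → allZ₇? λ i → line-step k (line-step k (line-step k (pt i))) ≟ₑ pt i) k i

frame-step³ : ∀ k i ζ → frame-step k (frame-step k (frame-step k (i , ζ))) ≡ (i , ζ)
frame-step³ = decide (all? λ k → allZ₇? λ i → allUnit? λ ζ →
  frame-step k (frame-step k (frame-step k (i , ζ))) ≟ₓ (i , ζ))

-- Solves τ = t + e - k for `k`: in `frame-step` the double block with repeated residue σ 2^e begins
-- at τ = 0 for σ = `⁺` and at τ = 1 for σ = `⁻`.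
double-class : Unit → Fin 3 → Fin 3
double-class (⁺ , e) t = t ⊹ e
double-class (⁻ , e) t = ⊟ 1F ⊹ (t ⊹ e)

frame-double : ∀ ((σ , e) : Unit) t →
  Triple (frame-step (double-class (σ , e) t))
    (just (σ , e) , ⁻ , t) (just (σ , e) , ⁻ , rotate t) (just (opposite σ , rotate e) , ⁺ , t)
frame-double = decide (allUnit? λ (σ , e) → all? λ t → triple? _≟ₓ_ _ _ _ _)

frame-triangle : ∀ ((σ , e) : Unit) t →
  Triple (frame-step (t ⊹ e))
    (just (σ , e) , ⁺ , t) (just (σ , rotate e) , ⁺ , rotate (rotate t))
    (just (σ , rotate (rotate e)) , ⁺ , rotate t)
frame-triangle = decide (allUnit? λ (σ , e) → all? λ t → triple? _≟ₓ_ _ _ _ _)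

antipodal-class : Fin 3 → Unit → Fin 3
antipodal-class e (⁺ , t) = ⊟ 1F ⊹ (t ⊹ e)
antipodal-class e (⁻ , t) = t ⊹ e

frame-antipodal : ∀ e ((ς , t) : Unit) →
  Triple (frame-step (antipodal-class e (ς , t)))
    (nothing , ς , t) (just (⁺ , e) , opposite ς , rotate t)
    (just (⁻ , e) , opposite ς , rotate (rotate t))
frame-antipodal = decide (all? λ e → allUnit? λ (ς , t) → triple? _≟ₓ_ _ _ _ _)

line-antipodal : ∀ e → Triple (line-step e) (pt nothing) (pt (just (⁺ , e))) (pt (just (⁻ , e)))
line-antipodal = decide (all? λ e → triple? _≟ₑ_ _ _ _ _)

-- In the affine plane, `∞ b` lies on the lines through 2^e and -2^(e + s), where s is 1 for `false`
-- and 2 for `true`. Thus `line-∞ b 0F` is s itself.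
line-∞ : Bool → Fin 3 → Fin 3
line-∞ false e = rotate e
line-∞ true  e = rotate (rotate e)

line-infinite : ∀ b e → Triple (line-step (⊟ line-∞ b 0F ⊹ e))
  (∞ b) (pt (just (⁺ , e))) (pt (just (⁻ , line-∞ b e)))
line-infinite false = decide (all? λ e → triple? _≟ₑ_ _ _ _ _)
line-infinite true  = decide (all? λ e → triple? _≟ₑ_ _ _ _ _)

-- The triples of residues with sum 0 modulo 7, and their translates

data Pattern : Z₇ → Z₇ → Z₇ → Set where
  level     : Pattern nothing nothing nothing
  antipodal : ∀ e → Pattern nothing (just (⁺ , e)) (just (⁻ , e))
  triangle  : ∀ σ → Pattern (just (σ , 0F)) (just (σ , 1F)) (just (σ , 2F))
  double    : ∀ σ e → Pattern (just (σ , e)) (just (σ , e)) (just (opposite σ , rotate e))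

pattern? : ∀ i j k → Maybe (Pattern i j k)
pattern? nothing nothing nothing = just level
pattern? nothing (just (⁺ , e)) (just (⁻ , e′)) with e Fin.≟ e′
... | yes refl = just (antipodal e)
... | no _     = nothing
pattern? (just (σ , 0F)) (just (σ′ , 1F)) (just (σ″ , 2F)) with σ Sign.≟ σ′ | σ Sign.≟ σ″
... | yes refl | yes refl = just (triangle σ)
... | _        | _        = nothing
pattern? (just (σ , e)) (just ζ) (just ζ′) with (σ , e) ≟ᵤ ζ | (opposite σ , rotate e) ≟ᵤ ζ′
... | yes refl | yes refl = just (double σ e)
... | _        | _        = nothing
pattern? _ _ _ = nothing

data Arranged : Z₇ → Z₇ → Z₇ → Set where
  arranged : ∀ {i j k} m → Pattern (i -₇ m) (j -₇ m) (k -₇ m) → Arranged i j k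
  rotated  : ∀ {i j k} → Arranged j k i → Arranged i j k
  swapped  : ∀ {i j k} → Arranged j i k → Arranged i j k

arranged? : ∀ i j k → Maybe (Arranged i j k)
arranged? i j k = cyclic i j k <∣> Maybe.map swapped (cyclic j i k)
  where
  -- 5 is the inverse of 3, so the three differences have sum 0.
  m : Z₇
  m = mod₇ (5 ℕ.* (residue i ℕ.+ residue j ℕ.+ residue k))
  try : ∀ i j k → Maybe (Arranged i j k)
  try i j k = Maybe.map (arranged m) (pattern? (i -₇ m) (j -₇ m) (k -₇ m))
  cyclic : ∀ i j k → Maybe (Arranged i j k)
  cyclic i j k = try i j k <∣> Maybe.map rotated (try j k i <∣> Maybe.map rotated (try k i j))

abstract
  -- Subtracting a third of the sum makes the sum 0, and the four patterns are, up to order, all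
  -- triples with sum 0. The search `arranged?` is evaluated on all 343 triples.
  arrangement : ∀ i j k → Arranged i j k
  arrangement i j k = to-witness (found i j k)
    where
    found : ∀ i j k → Is-just (arranged? i j k)
    found = decide (allZ₇? λ i → allZ₇? λ j → allZ₇? λ k → MaybeAny.dec (λ _ → yes tt) (arranged? i j k))

Infinite : Bool → Z₇ → Z₇ → Set
Infinite b i j = ∃₂ λ m e → i -₇ m ≡ just (⁺ , e) × j -₇ m ≡ just (⁻ , line-∞ b e)

-- Since 1 + 2 + 4 = 0 modulo 7, the difference -2^e is 2^(e + s) + 2^(e + 2s) for s = 1, 2. Hence
-- the positive residue is 2^(e + s), and `m` is i - 2^(e + s).
infinite : ∀ b e i j → i -₇ j ≡ just (⁻ , e) → Infinite b i j
infinite b e i j eq = let p , q = at b e j in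
  j +₇ just (⁻ , e) -₇ just (⁺ , line-∞ b e) , line-∞ b e ,
  trans (cong (_-₇ (j +₇ just (⁻ , e) -₇ just (⁺ , line-∞ b e)))
    (trans (sym (-₇-+₇ i j)) (trans (cong (_+₇ j) eq) (+₇-comm _ j)))) p , q
  where
  +₇-comm : ∀ i j → i +₇ j ≡ j +₇ i
  +₇-comm = decide (allZ₇? λ i → allZ₇? λ j → (i +₇ j) ≟₇ (j +₇ i))
  at : ∀ b e j → let m = j +₇ just (⁻ , e) -₇ just (⁺ , line-∞ b e) in
    j +₇ just (⁻ , e) -₇ m ≡ just (⁺ , line-∞ b e) ×
    j -₇ m ≡ just (⁻ , line-∞ b (line-∞ b e))
  at false = decide (all? λ e → allZ₇? λ j → (_ ≟₇ _) ×-dec (_ ≟₇ _))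
  at true  = decide (all? λ e → allZ₇? λ j → (_ ≟₇ _) ×-dec (_ ≟₇ _))

flip-sign : ∀ i j e → i -₇ j ≡ just (⁺ , e) → j -₇ i ≡ just (⁻ , e)
flip-sign i j e eq = trans (negate j i) (trans (cong (nothing -₇_) eq) (negate-⁺ e))
  where
  negate-⁺ : ∀ e → nothing -₇ just (⁺ , e) ≡ just (⁻ , e)
  negate-⁺ = decide (all? λ e → _ ≟₇ _)
  negate : ∀ i j → i -₇ j ≡ nothing -₇ (j -₇ i)
  negate = decide (allZ₇? λ i → allZ₇? λ j → (i -₇ j) ≟₇ (nothing -₇ (j -₇ i)))

abstract
  infinite-arrangement : ∀ b i j → i ≢ j → Infinite b i j ⊎ Infinite b j i
  infinite-arrangement b i j i≢j with i -₇ j in eq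
  ... | nothing      = contradiction (-₇≡nothing i j eq) i≢j
  ... | just (⁻ , e) = inj₁ (infinite b e i j eq)
  ... | just (⁺ , e) = inj₂ (infinite b e j i (flip-sign i j e eq))

-- Base systems

Block-resp : ∀ {V : Set} {n : V → V} {x x′ y y′ z z′} → x ≡ x′ → y ≡ y′ → z ≡ z′ →
  Block n x y z → Block n x′ y′ z′
Block-resp refl refl refl b = b

conjugate-Triple-to : ∀ {V W : Set} (e : V ↔ W) {n : V → V} {x y z} → Triple n x y z →
  let open Inverse e in Triple (conjugate e n) (to x) (to y) (to z)
conjugate-Triple-to e {n} (p , q) =
  cong to (trans (cong n (strictlyInverseʳ _)) p) ,
  cong to (trans (cong n (strictlyInverseʳ _)) q)
  where open Inverse e

module Construction {G : Set} {r : ℕ} (D : DiscreteOrthomorphism G r) where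
  open DiscreteOrthomorphism D
  open AbelianSolver isAbelianGroup

  private
    group : AbelianGroup 0ℓ 0ℓ
    group = record { isAbelianGroup = isAbelianGroup }
  open AbelianGroup group using (identityˡ; identityʳ)
  open AbelianGroupProperties group using (⁻¹-involutive; ε⁻¹≈ε)

  -- The classes `inj₁` extend those of the KTS(q + 2); `inj₂ (g , k)` is the k-th rotation of the
  -- frame around the line of `g`.
  Point Class : Set
  Point = Ext (Z₇ × G)
  Class = Maybe (Fin 3 × Fin r) ⊎ (G × Fin 3)

  f² : G → G
  f² a = f (f a)

  -- The relation 1 + ω + ω² = 0 solved for ω². It eliminates `f²` so that the solver for abelian
  -- groups applies.
  f²≡ : ∀ a → f² a ≡ - (a + f a)
  f²≡ a = begin
    f² a
      ≡⟨ prove v₂ (:- (v₀ :+ v₁) :+ ((v₀ :+ v₁) :+ v₂)) (a ∷ f a ∷ f² a ∷ []) refl ⟩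
    - (a + f a) + ((a + f a) + f² a)      ≡⟨ cong (- (a + f a) +_) (sum-zero a) ⟩
    - (a + f a) + 0#                      ≡⟨ identityʳ _ ⟩
    - (a + f a)                           ∎
    where open ≡-Reasoning

  f^-odd : ∀ t a → f^ t (- a) ≡ - f^ t a
  f^-odd 0F a = refl
  f^-odd 1F a = odd a
  f^-odd 2F a = trans (cong f (odd a)) (odd (f a))

  f-act : ∀ ((σ , t) : Unit) a → f (act (σ , t) a) ≡ act (σ , rotate t) a
  f-act (⁺ , t) a = f-f^ f³ t a
  f-act (⁻ , t) a = trans (odd _) (cong -_ (f-f^ f³ t a))

  neg-act : ∀ ((σ , t) : Unit) a → - act (σ , t) a ≡ act (opposite σ , t) a
  neg-act (⁺ , t) a = refl
  neg-act (⁻ , t) a = ⁻¹-involutive _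

  -f-act : ∀ ((σ , t) : Unit) a → act (opposite σ , rotate t) a ≡ - f (act (σ , t) a)
  -f-act (σ , t) a = trans (sym (neg-act (σ , rotate t) a)) (cong -_ (sym (f-act (σ , t) a)))

  act-inverse : ∀ ((σ , t) : Unit) a → act (σ , t) (act (σ , ⊟ t) a) ≡ a
  act-inverse (⁺ , t) a = trans (f^-⊹ f³ t (⊟ t) a) (cong (λ s → f^ s a) (⊟-inverseʳ t))
  act-inverse (⁻ , t) a = trans (cong -_ (f^-odd t _))
    (trans (⁻¹-involutive _) (act-inverse (⁺ , t) a))

  -- The product i g in the line {(i , i g)}, with ω acting as `f`.
  multiple : Z₇ → G → G
  multiple nothing  g = 0#
  multiple (just ζ) g = act ζ g

  -- Coordinates relative to the line of `g`: the residue, and the name of the offset from the line.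
  shear : G → (Z₇ × Maybe (Unit × Fin r)) ↔ (Z₇ × G)
  shear g = mk↔ₛ′
    (λ (i , w) → i , multiple i g + place w)
    (λ (i , h) → i , coord (h - multiple i g))
    (λ (i , h) → cong (i ,_) (trans (cong (multiple i g +_) (place-coord _))
      (prove (v₀ :+ (v₁ :- v₀)) v₁ (multiple i g ∷ h ∷ []) refl)))
    (λ (i , w) → cong (i ,_) (trans (cong coord
      (prove ((v₀ :+ v₁) :- v₀) v₁ (multiple i g ∷ place w ∷ []) refl)) (coord-place w)))

  on-line : Ext Z₇ → Ext (Z₇ × Maybe (Unit × Fin r))
  on-line = mapExt (_, nothing)

  off-line : Fin r → Z₇ × Unit → Ext (Z₇ × Maybe (Unit × Fin r))
  off-line y (i , ζ) = pt (i , just (ζ , y))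

  -- The points (i , nothing) are those of the line itself.
  frame : Fin 3 → Ext (Z₇ × Maybe (Unit × Fin r)) → Ext (Z₇ × Maybe (Unit × Fin r))
  frame k (∞ b)                   = on-line (line-step k (∞ b))
  frame k (pt (i , nothing))      = on-line (line-step k (pt i))
  frame k (pt (i , just (ζ , y))) = off-line y (frame-step k (i , ζ))

  frame-line : ∀ k x → frame k (on-line x) ≡ on-line (line-step k x)
  frame-line k (∞ b)  = refl
  frame-line k (pt i) = refl

  frame³ : ∀ k x → frame k (frame k (frame k x)) ≡ x
  frame³ k (∞ b) = trans
    (cong (frame k) (frame-line k (line-step k (∞ b))))
    (trans (frame-line k (line-step k (line-step k (∞ b)))) (cong on-line (line-step³ k (∞ b))))
  frame³ k (pt (i , nothing)) = trans
    (cong (frame k) (frame-line k (line-step k (pt i))))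
    (trans (frame-line k (line-step k (line-step k (pt i)))) (cong on-line (line-step³ k (pt i))))
  frame³ k (pt (i , just (ζ , y))) = cong (off-line y) (frame-step³ k i ζ)

  line-Triple : ∀ k {x y z} → Triple (line-step k) x y z →
    Triple (frame k) (on-line x) (on-line y) (on-line z)
  line-Triple k {x} (refl , refl) = frame-line k x , frame-line k (line-step k x)

  frame-Triple : ∀ k y {u v w} → Triple (frame-step k) u v w →
    Triple (frame k) (off-line y u) (off-line y v) (off-line y w)
  frame-Triple k y (p , q) = cong (off-line y) p , cong (off-line y) q

  lift : Z₇ → Ext G → Point
  lift m = mapExt (m ,_)

  -- The offsets are 0 and the elements of -G⁺: 1 + 3r in all, as many as a KTS(q + 2) has classes.
  -- The class of offset 0 contains the affine lines with residues 1, 2, 4 and 6, 5, 3.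
  shift-offset : Maybe (Fin 3 × Fin r) → G
  shift-offset nothing        = 0#
  shift-offset (just (t , y)) = - f^ t (rep y)

  f^-zero : ∀ t → f^ t 0# ≡ 0#
  f^-zero 0F = refl
  f^-zero 1F = f-zero
  f^-zero 2F = trans (cong f f-zero) f-zero

  f^-⊟-rotate : ∀ e a → f^ (⊟ rotate e) a ≡ f² (f^ (⊟ e) a)
  f^-⊟-rotate 0F a = refl
  f^-⊟-rotate 1F a = sym (cong f (f³ a))
  f^-⊟-rotate 2F a = sym (f³ a)

  shift-offset-surjective : ∀ e t y → f^ (⊟ e) (shift-offset (just (e ⊹ t , y))) ≡ - f^ t (rep y)
  shift-offset-surjective e t y = begin
    f^ (⊟ e) (- f^ (e ⊹ t) (rep y))        ≡⟨ cong (f^ (⊟ e) ∘ -_) (f^-⊹ f³ e t (rep y)) ⟨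
    f^ (⊟ e) (- f^ e (f^ t (rep y)))       ≡⟨ cong (f^ (⊟ e)) (f^-odd e _) ⟨
    f^ (⊟ e) (f^ e (- f^ t (rep y)))       ≡⟨ f^-⊹ f³ (⊟ e) e _ ⟩
    f^ (⊟ e ⊹ e) (- f^ t (rep y))          ≡⟨ cong (λ s → f^ s _) (⊟-inverse e) ⟩
    - f^ t (rep y)                         ∎
    where open ≡-Reasoning

  -- Residue 0 and the points `∞` are left to `n`. A point of residue ±2^e is read as l + ω^(-e) a;
  -- doubling the residue applies `f` to l and multiplies the offset by ω^(-1), which traces a
  -- triangle block.
  fill : G → (Ext G → Ext G) → Point → Point
  fill a n (∞ b)                  = lift nothing (n (∞ b))
  fill a n (pt (nothing , h))     = lift nothing (n (pt h))
  fill a n (pt (just (σ , e) , h)) =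
    pt (just (σ , rotate e) , f (h - f^ (⊟ e) a) + f^ (⊟ rotate e) a)

  fill-lift : ∀ a n x → fill a n (lift nothing x) ≡ lift nothing (n x)
  fill-lift a n (∞ b)  = refl
  fill-lift a n (pt h) = refl

  fill³ : ∀ a {n} → (∀ x → n (n (n x)) ≡ x) → ∀ x → fill a n (fill a n (fill a n x)) ≡ x
  fill³ a {n} n³ (∞ b) = trans (cong (fill a n) (fill-lift a n _))
    (trans (fill-lift a n _) (cong (lift nothing) (n³ _)))
  fill³ a {n} n³ (pt (nothing , h)) = trans (cong (fill a n) (fill-lift a n _))
    (trans (fill-lift a n _) (cong (lift nothing) (n³ _)))
  fill³ a n³ (pt (just (σ , e) , h)) = cong pt (cong₂ _,_ (cong (λ e → just (σ , e)) (rotate³ e)) eq)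
    where
    open ≡-Reasoning
    A = λ e → f^ (⊟ e) a
    cancel : ∀ x y → x + y - y ≡ x
    cancel x y = prove (v₀ :+ v₁ :- v₁) v₀ (x ∷ y ∷ []) refl
    x = h - A e
    eq : f (f (f x + A (rotate e) - A (rotate e)) + A (rotate (rotate e)) - A (rotate (rotate e)))
      + A (rotate (rotate (rotate e))) ≡ h
    eq = begin
      f (f (f x + A (rotate e) - A (rotate e)) + A (rotate (rotate e)) - A (rotate (rotate e)))
        + A (rotate (rotate (rotate e)))
        ≡⟨ cong₂ (λ y e → f y + A e) (cancel _ _) (rotate³ e) ⟩
      f (f (f x + A (rotate e) - A (rotate e))) + A e
        ≡⟨ cong (λ y → f (f y) + A e) (cancel _ _) ⟩
      f (f (f x)) + A e
        ≡⟨ cong (_+ A e) (f³ x) ⟩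
      h - A e + A e
        ≡⟨ prove (v₀ :- v₁ :+ v₁) v₀ (h ∷ A e ∷ []) refl ⟩
      h ∎

  module Base (K : Maybe (Fin 3 × Fin r) → Ext G → Ext G) (K³ : ∀ c x → K c (K c (K c x)) ≡ x) where

    next : Class → Point → Point
    next (inj₁ c)       = fill (shift-offset c) (K c)
    next (inj₂ (g , k)) = conjugate (Ext-↔ (shear g)) (frame k)

    next³ : ∀ c x → next c (next c (next c x)) ≡ x
    next³ (inj₁ c)       = fill³ (shift-offset c) (K³ c)
    next³ (inj₂ (g , k)) = conjugate-cube (Ext-↔ (shear g)) {frame k} (frame³ k)

    InTriple : Point → Point → Point → Set
    InTriple x y z = ∃ λ c → Triple (next c) x y z

    in-frame : ∀ g k {x y z x′ y′ z′} → Triple (frame k) x y z →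
      let open Inverse (Ext-↔ (shear g)) in to x ≡ x′ → to y ≡ y′ → to z ≡ z′ → InTriple x′ y′ z′
    in-frame g k t refl refl refl = inj₂ (g , k) , conjugate-Triple-to (Ext-↔ (shear g)) t

    lift-Block : ∀ {c x y z} → Block (K c) x y z →
      Block (next (inj₁ c)) (lift nothing x) (lift nothing y) (lift nothing z)
    lift-Block {c} (inj₁ (refl , refl)) =
      inj₁ (fill-lift (shift-offset c) (K c) _ , fill-lift (shift-offset c) (K c) _)
    lift-Block {c} (inj₂ (refl , refl)) =
      inj₂ (fill-lift (shift-offset c) (K c) _ , fill-lift (shift-offset c) (K c) _)

    pt-cong : ∀ {i : Z₇} {h h′ : G} → h ≡ h′ → _≡_ {A = Point} (pt (i , h)) (pt (i , h′))
    pt-cong = cong (λ h → pt (_ , h))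

    -- Residues i, i and -2i.
    double-triple : ∀ ((σ , e) : Unit) a l → G⁺ a → InTriple
      (pt (just (σ , e) , l - a)) (pt (just (σ , e) , l - f a))
      (pt (just (opposite σ , rotate e) , a - f l))
    double-triple (σ , e) a l (t , y , refl) =
      in-frame g (double-class (σ , e) t) (frame-Triple (double-class (σ , e) t) y (frame-double (σ , e) t))
        (pt-cong (cong (_+ - a) (act-inverse (σ , e) l)))
        (pt-cong (cong₂ _+_ (act-inverse (σ , e) l) (cong -_ (sym (f-f^ f³ t (rep y))))))
        (pt-cong third)
      where
      -- The line with i g = l, where i = σ 2^e.
      g = act (σ , ⊟ e) l
      third : act (opposite σ , rotate e) g + a ≡ a - f l
      third = trans (cong (_+ a) (trans (-f-act (σ , e) g) (cong (λ x → - f x) (act-inverse (σ , e) l))))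
        (prove (:- v₀ :+ v₁) (v₁ :- v₀) (f l ∷ a ∷ []) refl)

    -- The offset of class `c` is the one seen at residue ±1; at residue ±2^e it appears multiplied
    -- by ω^(-e).
    shift-triple : ∀ c ((σ , e) : Unit) l {a} → f^ (⊟ e) (shift-offset c) ≡ a → InTriple
      (pt (just (σ , e) , l + a))
      (pt (just (σ , rotate e) , f l + f² a))
      (pt (just (σ , rotate (rotate e)) , f² l + f a))
    shift-triple c (σ , e) l {a} refl = inj₁ c ,
      pt-cong (cong₂ _+_ (cong f (cancel l a)) eq₁) , pt-cong (cong₂ _+_ (cong f (begin
        f l + f² a - f^ (⊟ rotate e) (shift-offset c)     ≡⟨ cong (λ b → f l + f² a - b) eq₁ ⟩
        f l + f² a - f² a                                 ≡⟨ cancel (f l) (f² a) ⟩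
        f l                                               ∎)) eq₂)
      where
      open ≡-Reasoning
      cancel : ∀ x y → x + y - y ≡ x
      cancel x y = prove (v₀ :+ v₁ :- v₁) v₀ (x ∷ y ∷ []) refl
      eq₁ : f^ (⊟ rotate e) (shift-offset c) ≡ f² a
      eq₁ = f^-⊟-rotate e (shift-offset c)
      eq₂ : f^ (⊟ rotate (rotate e)) (shift-offset c) ≡ f a
      eq₂ = trans (f^-⊟-rotate (rotate e) (shift-offset c)) (trans (cong f² eq₁) (cong f (f³ a)))

    -- Residues i, 2i and 4i.
    triangle-triple : ∀ ((σ , e) : Unit) l a → InTriple
      (pt (just (σ , e) , l + a))
      (pt (just (σ , rotate e) , f l + f² a))
      (pt (just (σ , rotate (rotate e)) , f² l + f a))
    -- For a = 0 and a in -G⁺ the block belongs to a class of the KTS(q + 2), where the exponent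
    -- `e ⊹ t` compensates the factor ω^(-e). For a in G⁺ it belongs to a frame.
    triangle-triple (σ , e) l a with coord a | place-coord a
    ... | nothing             | refl = shift-triple nothing (σ , e) l (f^-zero (⊟ e))
    ... | just ((⁻ , t) , y) | refl =
      shift-triple (just (e ⊹ t , y)) (σ , e) l (shift-offset-surjective e t y)
    ... | just ((⁺ , t) , y) | refl =
      in-frame g (t ⊹ e) (frame-Triple (t ⊹ e) y (frame-triangle (σ , e) t))
        (pt-cong (cong (_+ a) (act-inverse (σ , e) l)))
        (pt-cong (cong₂ _+_ fl≡ (sym (trans (cong f (f-f^ f³ t (rep y))) (f-f^ f³ (rotate t) (rep y))))))
        (pt-cong (cong₂ _+_ (trans (sym (f-act (σ , rotate e) g)) (cong f fl≡)) (sym (f-f^ f³ t (rep y)))))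
      where
      g = act (σ , ⊟ e) l
      fl≡ : act (σ , rotate e) g ≡ f l
      fl≡ = trans (sym (f-act (σ , e) g)) (cong f (act-inverse (σ , e) l))

    -- The blocks with u = 0 lie on a line.
    antipodal-triple : ∀ e u l → InTriple
      (pt (nothing , u)) (pt (just (⁺ , e) , l - f u)) (pt (just (⁻ , e) , - l - f² u))
    antipodal-triple e u l with coord u | place-coord u
    ... | nothing | refl =
      in-frame g e (line-Triple e (line-antipodal e))
        (pt-cong (identityˡ 0#))
        (pt-cong (cong₂ _+_ (act-inverse (⁺ , e) l) (sym -f0≡0)))
        (pt-cong (cong₂ _+_ (cong -_ (act-inverse (⁺ , e) l))
          (sym (trans (cong (-_ ∘ f) f-zero) -f0≡0))))
      where
      g = act (⁺ , ⊟ e) l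
      -f0≡0 : - f 0# ≡ 0#
      -f0≡0 = trans (cong -_ f-zero) ε⁻¹≈ε
    ... | just ((ς , t) , y) | refl =
      in-frame g k (frame-Triple k y (frame-antipodal e (ς , t)))
        (pt-cong (identityˡ u))
        (pt-cong (cong₂ _+_ (act-inverse (⁺ , e) l) (-f-act (ς , t) (rep y))))
        (pt-cong (cong₂ _+_ (cong -_ (act-inverse (⁺ , e) l))
          (trans (-f-act (ς , rotate t) (rep y)) (cong (λ x → - f x) (sym (f-act (ς , t) (rep y)))))))
      where
      g = act (⁺ , ⊟ e) l
      k = antipodal-class e (ς , t)

    infinite-triple : ∀ b e l → InTriple
      (∞ b) (pt (just (⁺ , e) , l)) (pt (just (⁻ , line-∞ b e) , - f^ (line-∞ b 0F) l))
    infinite-triple b e l = in-frame g k (line-Triple k (line-infinite b e))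
      refl
      (pt-cong (trans (identityʳ _) (act-inverse (⁺ , e) l)))
      (pt-cong (trans (identityʳ _) (cong -_ (third b))))
      where
      g = act (⁺ , ⊟ e) l
      k = ⊟ line-∞ b 0F ⊹ e
      fg≡ : f^ (rotate e) g ≡ f l
      fg≡ = trans (sym (f-f^ f³ e g)) (cong f (act-inverse (⁺ , e) l))
      third : ∀ b → f^ (line-∞ b e) g ≡ f^ (line-∞ b 0F) l
      third false = fg≡
      third true  = trans (sym (f-f^ f³ (rotate e) g)) (cong f fg≡)

    -- Pairs of points in a base system

    InTriple-resp : ∀ {x x′ y y′ z z′} → x ≡ x′ → y ≡ y′ → z ≡ z′ → InTriple x y z → InTriple x′ y′ z′
    InTriple-resp refl refl refl t = t

    Joined : Point → Point → Set
    Joined x y = ∃₂ λ c z → Block (next c) x y z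

    Joined-sym : ∀ {x y} → Joined x y → Joined y x
    Joined-sym (c , z , b) = c , z , Block-swap (next³ c) b

    Joined-resp : ∀ {x x′ y y′} → x ≡ x′ → y ≡ y′ → Joined x y → Joined x′ y′
    Joined-resp refl refl j = j

    joined₁₂ : ∀ {x y z} → InTriple x y z → Joined x y
    joined₁₂ (c , t) = c , _ , inj₁ t

    joined₂₃ : ∀ {x y z} → InTriple x y z → Joined y z
    joined₂₃ (c , t) = c , _ , inj₁ (Triple-rotate (next³ c) t)

    joined₁₃ : ∀ {x y z} → InTriple x y z → Joined x z
    joined₁₃ (c , t) = c , _ , inj₂ (Triple-rotate (next³ c) (Triple-rotate (next³ c) t))

    pt-cong₂ : ∀ {σ e e′} {h h′ : G} → e ≡ e′ → h ≡ h′ →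
      _≡_ {A = Point} (pt (just (σ , e) , h)) (pt (just (σ , e′) , h′))
    pt-cong₂ refl refl = refl

    joined-antipodal : ∀ e h h′ → Joined (pt (just (⁺ , e) , h)) (pt (just (⁻ , e) , h′))
    joined-antipodal e h h′ = Joined-resp (pt-cong fst≡) (pt-cong snd≡)
      (joined₂₃ (antipodal-triple e u (h + f u)))
      where
      -- The coordinates at 2^e and -2^e of an antipodal block add up to -(f u + f² u) = u.
      u = h + h′
      fst≡ : h + f u - f u ≡ h
      fst≡ = prove (v₀ :+ v₁ :- v₁) v₀ (h ∷ f u ∷ []) refl
      snd≡ : - (h + f u) - f² u ≡ h′
      snd≡ = trans (cong (λ x → - (h + f u) - x) (f²≡ u))
        (prove (:- (v₀ :+ v₁) :- (:- ((v₀ :+ v₂) :+ v₁))) v₂ (h ∷ f u ∷ h′ ∷ []) refl)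

    -- Condition (6) provides `a` with f² a + f (h - a) = h′, and the triangle block has l = h - a.
    joined-rotate : ∀ ((σ , e) : Unit) h h′ → Joined (pt (just (σ , e) , h)) (pt (just (σ , rotate e) , h′))
    joined-rotate ζ h h′ with a , eq ← shift h h′ = Joined-resp
      (pt-cong (prove (v₀ :- v₁ :+ v₁) v₀ (h ∷ a ∷ []) refl))
      (pt-cong (trans (prove (v₀ :+ v₁) (v₁ :+ v₀) (f (h - a) ∷ f² a ∷ []) refl) eq))
      (joined₁₂ (triangle-triple ζ (h - a) a))

    -- If h′ + f h = 0, the points lie on a common line and an affine block through a point `∞`
    -- joins them. Otherwise condition (7) writes h′ + f h in one of two forms: the first uses the
    -- first point of a double block, the second uses the second point of the block for f² a, as f
    -- (f² a) = a.
    joined-neg-rotate : ∀ ((σ , e) : Unit) h h′ →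
      Joined (pt (just (σ , e) , h)) (pt (just (opposite σ , rotate e) , h′))
    joined-neg-rotate (σ , e) h h′ with coord (h′ + f h) in eq
    ... | nothing = collinear σ h′≡
      where
      h′≡ : h′ ≡ - f h
      h′≡ = begin
        h′                              ≡⟨ prove v₀ (v₀ :+ v₁ :- v₁) (h′ ∷ f h ∷ []) refl ⟩
        h′ + f h - f h                  ≡⟨ cong (_- f h) (place-coord (h′ + f h)) ⟨
        place (coord (h′ + f h)) - f h  ≡⟨ cong (λ w → place w - f h) eq ⟩
        0# - f h                        ≡⟨ identityˡ _ ⟩
        - f h                           ∎
        where open ≡-Reasoning
      collinear : ∀ σ → h′ ≡ - f h →
        Joined (pt (just (σ , e) , h)) (pt (just (opposite σ , rotate e) , h′))
      collinear ⁺ refl = joined₂₃ (infinite-triple false e h)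
      collinear ⁻ refl = Joined-sym (Joined-resp refl (pt-cong₂ (rotate³ e) (begin
        - f² (- f h)    ≡⟨ cong -_ (f^-odd 2F (f h)) ⟩
        - (- f² (f h))  ≡⟨ ⁻¹-involutive _ ⟩
        f² (f h)        ≡⟨ f³ h ⟩
        h               ∎)) (joined₂₃ (infinite-triple true (rotate e) (- f h))))
        where open ≡-Reasoning
    ... | just w with difference h {h′ + f h} nonzero
      where
      nonzero : h′ + f h ≢ 0#
      nonzero ≡0 with () ← trans (sym (trans (cong coord ≡0) (coord-place nothing))) eq
    ...   | a , a∈ , inj₁ eq′ = Joined-resp
      (pt-cong (prove (v₀ :+ v₁ :- v₀) v₁ (a ∷ h ∷ []) refl))
      (pt-cong (begin
        a - f (a + h)
          ≡⟨ prove (v₀ :- v₂) (v₀ :+ v₁ :- v₂ :- v₁) (a ∷ f h ∷ f (a + h) ∷ []) refl ⟩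
        a + f h - f (a + h) - f h        ≡⟨ cong (_- f h) eq′ ⟩
        h′ + f h - f h                   ≡⟨ prove (v₀ :+ v₁ :- v₁) v₀ (h′ ∷ f h ∷ []) refl ⟩
        h′                               ∎))
      (joined₁₃ (double-triple (σ , e) a (a + h) a∈))
      where open ≡-Reasoning
    ...   | a , (t , y , refl) , inj₂ eq′ = Joined-resp
      (pt-cong (trans (cong (λ x → a + h - x) (f³ a)) (prove (v₀ :+ v₁ :- v₀) v₁ (a ∷ h ∷ []) refl)))
      (pt-cong (begin
        f² a - f (a + h)
          ≡⟨ prove (v₀ :- v₂) (v₀ :+ v₁ :- v₂ :- v₁) (f² a ∷ f h ∷ f (a + h) ∷ []) refl ⟩
        f² a + f h - f (a + h) - f h     ≡⟨ cong (_- f h) eq′ ⟩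
        h′ + f h - f h                   ≡⟨ prove (v₀ :+ v₁ :- v₁) v₀ (h′ ∷ f h ∷ []) refl ⟩
        h′                               ∎))
      (joined₂₃ (double-triple (σ , e) (f² a) (a + h) (2F ⊹ t , y , f^-⊹ f³ 2F t (rep y))))
      where open ≡-Reasoning

    data Orthogonal (d : G) : Set where
      direct : ∀ a → G⁺ a → f a - a ≡ d → Orthogonal d
      reversed : ∀ a → G⁺ a → f a - a ≡ - d → Orthogonal d

    -- The solution of f a - a = d is nonzero. If it lies in -G⁺, oddness turns its negative into a
    -- solution for -d, which amounts to exchanging the two points of equal residue.
    orthogonal : ∀ {d} → d ≢ 0# → Orthogonal d
    orthogonal {d} d≢0 with orthomorphism d
    ... | a , eq with coord a | place-coord a
    ...   | nothing             | refl = contradiction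
      (trans (sym eq) (trans (cong (_- 0#) f-zero) (prove (:0 :- :0) :0 [] refl))) d≢0
    ...   | just ((⁺ , t) , y) | refl = direct a (t , y , refl) eq
    ...   | just ((⁻ , t) , y) | refl = reversed (f^ t (rep y)) (t , y , refl) (begin
      f b - b            ≡⟨ prove (v₀ :- v₁) (:- (:- v₀ :- :- v₁)) (f b ∷ b ∷ []) refl ⟩
      - (- f b - (- b))  ≡⟨ cong (λ x → - (x - (- b))) (odd b) ⟨
      - (f (- b) - - b)  ≡⟨ cong -_ eq ⟩
      - d                ∎)
      where
      open ≡-Reasoning
      b = f^ t (rep y)

    -≢0 : ∀ {h h′} → h ≢ h′ → h - h′ ≢ 0#
    -≢0 {h} {h′} h≢h′ eq = h≢h′ (begin
      h              ≡⟨ prove v₀ (v₀ :- v₁ :+ v₁) (h ∷ h′ ∷ []) refl ⟩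
      h - h′ + h′    ≡⟨ cong (_+ h′) eq ⟩
      0# + h′        ≡⟨ identityˡ h′ ⟩
      h′             ∎)
      where open ≡-Reasoning

    -- With l = h + a the two points of equal residue are h and h - (f a - a).
    double-triple′ : ∀ ((σ , e) : Unit) {a h h′} → G⁺ a → f a - a ≡ h - h′ → InTriple
      (pt (just (σ , e) , h)) (pt (just (σ , e) , h′))
      (pt (just (opposite σ , rotate e) , a - f (h + a)))
    double-triple′ ζ {a} {h} {h′} a∈ eq = InTriple-resp
      (pt-cong (prove (v₀ :+ v₁ :- v₁) v₀ (h ∷ a ∷ []) refl))
      (pt-cong (begin
        h + a - f a          ≡⟨ prove (v₀ :+ v₁ :- v₂) (v₀ :- (v₂ :- v₁)) (h ∷ a ∷ f a ∷ []) refl ⟩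
        h - (f a - a)        ≡⟨ cong (λ x → h - x) eq ⟩
        h - (h - h′)         ≡⟨ prove (v₀ :- (v₀ :- v₁)) v₁ (h ∷ h′ ∷ []) refl ⟩
        h′                   ∎))
      refl
      (double-triple ζ a (h + a) a∈)
      where open ≡-Reasoning

    joined-same : ∀ ζ {h h′} → h ≢ h′ → Joined (pt (just ζ , h)) (pt (just ζ , h′))
    joined-same ζ {h} {h′} h≢h′ with orthogonal (-≢0 h≢h′)
    ... | direct a a∈ eq = joined₁₂ (double-triple′ ζ a∈ eq)
    ... | reversed a a∈ eq = Joined-sym (joined₁₂ (double-triple′ ζ a∈
      (trans eq (prove (:- (v₀ :- v₁)) (v₁ :- v₀) (h ∷ h′ ∷ []) refl))))

    joined-zero : ∀ ζ h h′ → Joined (pt (nothing , h)) (pt (just ζ , h′))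
    joined-zero (⁺ , e) h h′ = Joined-resp refl
      (pt-cong (prove (v₀ :+ v₁ :- v₁) v₀ (h′ ∷ f h ∷ []) refl))
      (joined₁₂ (antipodal-triple e h (h′ + f h)))
    joined-zero (⁻ , e) h h′ = Joined-resp refl
      (pt-cong (prove (:- (:- v₀ :- v₁) :- v₁) v₀ (h′ ∷ f² h ∷ []) refl))
      (joined₁₃ (antipodal-triple e h (- h′ - f² h)))

    joined-infinite : ∀ b ζ h → Joined (∞ b) (pt (just ζ , h))
    joined-infinite b (⁺ , e) h = joined₁₂ (infinite-triple b e h)
    -- The exponent shifts of the two points `∞` are 1 and 2, so `line-∞ (not b)` inverts `line-∞ b`
    -- modulo 3.
    joined-infinite b (⁻ , e) h = Joined-resp refl (pt-cong₂ (e≡ b) (h≡ b))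
      (joined₁₃ (infinite-triple b (line-∞ (not b) e) (- f^ (line-∞ (not b) 0F) h)))
      where
      e≡ : ∀ b → line-∞ b (line-∞ (not b) e) ≡ e
      e≡ false = rotate³ e
      e≡ true  = rotate³ e
      h≡ : ∀ b → - f^ (line-∞ b 0F) (- f^ (line-∞ (not b) 0F) h) ≡ h
      h≡ false = trans (cong -_ (odd _)) (trans (⁻¹-involutive _) (f³ h))
      h≡ true  = trans (cong -_ (f^-odd 2F _)) (trans (⁻¹-involutive _) (f³ h))

    -- The ratio of the residues is one of 1, 2, 4, -1, -2, -4. Since 4 is the inverse of 2 modulo
    -- 7, the ratios 4 and -4 reduce to 2 and -2 with the points exchanged.
    joined-units : ∀ ((σ , e) : Unit) ((σ′ , e′) : Unit) {h h′} →
      _≢_ {A = Point} (pt (just (σ , e) , h)) (pt (just (σ′ , e′) , h′)) →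
      Joined (pt (just (σ , e) , h)) (pt (just (σ′ , e′) , h′))
    joined-units (σ , e) (σ′ , e′) {h} {h′} x≢y with σ Sign.≟ σ′ | rotate-exhausts e e′
    ... | yes refl | inj₁ refl        = joined-same (σ , e) (x≢y ∘ pt-cong)
    ... | yes refl | inj₂ (inj₁ refl) = joined-rotate (σ , e) h h′
    ... | yes refl | inj₂ (inj₂ refl) = Joined-sym (Joined-resp refl (pt-cong₂ (rotate³ e) refl)
      (joined-rotate (σ , rotate (rotate e)) h′ h))
    joined-units (⁺ , e) (⁺ , e′) _ | no σ≢σ′ | _ = contradiction refl σ≢σ′
    joined-units (⁻ , e) (⁻ , e′) _ | no σ≢σ′ | _ = contradiction refl σ≢σ′
    joined-units (⁺ , e) (⁻ , e′) {h} {h′} _ | no _ | inj₁ refl = joined-antipodal e h h′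
    joined-units (⁻ , e) (⁺ , e′) {h} {h′} _ | no _ | inj₁ refl = Joined-sym (joined-antipodal e h′ h)
    joined-units (⁺ , e) (⁻ , e′) {h} {h′} _ | no _ | inj₂ (inj₁ refl) = joined-neg-rotate (⁺ , e) h h′
    joined-units (⁻ , e) (⁺ , e′) {h} {h′} _ | no _ | inj₂ (inj₁ refl) = joined-neg-rotate (⁻ , e) h h′
    joined-units (⁺ , e) (⁻ , e′) {h} {h′} _ | no _ | inj₂ (inj₂ refl) = Joined-sym
      (Joined-resp refl (pt-cong₂ (rotate³ e) refl) (joined-neg-rotate (⁻ , rotate (rotate e)) h′ h))
    joined-units (⁻ , e) (⁺ , e′) {h} {h′} _ | no _ | inj₂ (inj₂ refl) = Joined-sym
      (Joined-resp refl (pt-cong₂ (rotate³ e) refl) (joined-neg-rotate (⁺ , rotate (rotate e)) h′ h))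

    module _ (K-joins : Joins K) where

      joined-lift : ∀ {x y} → x ≢ y → Joined (lift nothing x) (lift nothing y)
      joined-lift x≢y with c , z , b ← K-joins x≢y = inj₁ c , lift nothing z , lift-Block b

      joins : Joins next
      joins {∞ b} {∞ b′} x≢y = joined-lift (x≢y ∘ cong (lift nothing))
      joins {∞ b} {pt (nothing , h)} x≢y = joined-lift (x≢y ∘ cong (lift nothing))
      joins {∞ b} {pt (just ζ , h)} x≢y = joined-infinite b ζ h
      joins {pt (nothing , h)} {∞ b} x≢y = joined-lift (x≢y ∘ cong (lift nothing))
      joins {pt (just ζ , h)} {∞ b} x≢y = Joined-sym (joined-infinite b ζ h)
      joins {pt (nothing , h)} {pt (nothing , h′)} x≢y = joined-lift (x≢y ∘ cong (lift nothing))
      joins {pt (nothing , h)} {pt (just ζ , h′)} x≢y = joined-zero ζ h h′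
      joins {pt (just ζ , h)} {pt (nothing , h′)} x≢y = Joined-sym (joined-zero ζ h′ h)
      joins {pt (just ζ , h)} {pt (just ζ′ , h′)} x≢y = joined-units ζ ζ′ x≢y

-- Translates

module LargeSet {G : Set} {r : ℕ} (D : DiscreteOrthomorphism G r)
  (third : DiscreteOrthomorphism.Trisectible D)
  (sub : KirkmanLargeSet G (Maybe (Fin 3 × Fin r)) (Ext G)) where

  open DiscreteOrthomorphism D
  open AbelianSolver isAbelianGroup
  open Construction D
  module Sub = KirkmanLargeSet sub

  private
    group : AbelianGroup 0ℓ 0ℓ
    group = record { isAbelianGroup = isAbelianGroup }
  open AbelianGroupProperties group using (⁻¹-involutive)

  -+ : ∀ h x → h - x + x ≡ h
  -+ h x = prove (v₀ :- v₁ :+ v₁) v₀ (h ∷ x ∷ []) refl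

  +- : ∀ h x → h + x - x ≡ h
  +- h x = prove (v₀ :+ v₁ :- v₁) v₀ (h ∷ x ∷ []) refl

  translation : G → Ext G ↔ Ext G
  translation x = Ext-↔ (mk↔ₛ′ (_+ x) (_- x) (λ h → -+ h x) (λ h → +- h x))

  translation₇ : Z₇ × G → Point ↔ Point
  translation₇ (m , x) = Ext-↔ (mk↔ₛ′ (λ (i , h) → i +₇ m , h + x) (λ (i , h) → i -₇ m , h - x)
    (λ (i , h) → cong₂ _,_ (-₇-+₇ i m) (-+ h x)) (λ (i , h) → cong₂ _,_ (+₇--₇ i m) (+- h x)))

  -- The x-th given system is first moved back by `x`, so that the translate by (m , x) contains it
  -- unmoved on {m} × G and the points `∞`. The triples in that set are therefore covered by the
  -- given large set.
  based : G → Maybe (Fin 3 × Fin r) → Ext G → Ext G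
  based x c = conjugate (↔-sym (translation x)) (Sub.next x c)

  based³ : ∀ x c p → based x c (based x c (based x c p)) ≡ p
  based³ x c = conjugate-cube (↔-sym (translation x)) {Sub.next x c} (Sub.next³ x c)

  module At x = Base (based x) (based³ x)

  next : Z₇ × G → Class → Point → Point
  next (m , x) c = conjugate (translation₇ (m , x)) (At.next x c)

  next³ : ∀ s c x → next s c (next s c (next s c x)) ≡ x
  next³ (m , x) c = conjugate-cube (translation₇ (m , x)) {At.next x c} (At.next³ x c)

  joins : ∀ s → Joins (next s)
  joins (m , x) = conjugate-joins (translation₇ (m , x)) (At.joins x
    (conjugate-joins (↔-sym (translation x)) (Sub.joins x)))

  -- Triples of points in the translates

  record Covered (p q u : Point) : Set where
    constructor covered
    field
      {system} : Z₇ × G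
      {class}  : Class
      block    : Block (next system class) p q u

  covered-rotate : ∀ {p q u} → Covered p q u → Covered q u p
  covered-rotate (covered {s} {c} b) = covered {system = s} {c} (Block-rotate (next³ s c) b)

  covered-swap : ∀ {p q u} → Covered p q u → Covered q p u
  covered-swap (covered {s} {c} b) = covered {system = s} {c} (Block-swap (next³ s c) b)

  module _ (m : Z₇) (x : G) where
    open Inverse (translation₇ (m , x))

    covered-by : ∀ {p q u} → At.InTriple x (from p) (from q) (from u) → Covered p q u
    covered-by (c , t) = covered {system = m , x} {c} (conjugate-Block (translation₇ (m , x)) (inj₁ t))

    from-lift : ∀ p → lift nothing (Inverse.from (translation x) p) ≡ from (lift m p)
    from-lift (∞ b)  = refl
    from-lift (pt h) = cong (λ i → pt (i , h - x)) (sym (i-₇i m))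

  covered-lift : ∀ m {p q u} → p ≢ q → q ≢ u → p ≢ u → Covered (lift m p) (lift m q) (lift m u)
  covered-lift m {p} {q} {u} p≢q q≢u p≢u with x , c , b ← Sub.covers p≢q q≢u p≢u =
    covered {system = m , x} {inj₁ c} (conjugate-Block (translation₇ (m , x)) (Block-resp
      (from-lift m x p) (from-lift m x q) (from-lift m x u) (At.lift-Block x
        (conjugate-Block (↔-sym (translation x)) (Block-resp (back p) (back q) (back u) b)))))
    where
    back : ∀ {x} p → p ≡ Inverse.to (translation x) (Inverse.from (translation x) p)
    back {x} p = sym (Inverse.strictlyInverseˡ (translation x) p)

  point≡ : ∀ {i i′ : Z₇} {h h′ : G} → i ≡ i′ → h ≡ h′ → _≡_ {A = Point} (pt (i , h)) (pt (i′ , h′))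
  point≡ refl refl = refl

  covered-infinite : ∀ b {i j h h′} → Infinite b i j → Covered (∞ b) (pt (i , h)) (pt (j , h′))
  covered-infinite b {i} {j} {h} {h′} (m , e , i≡ , j≡) = covered-by m x
    (At.InTriple-resp x refl (point≡ (sym i≡) l≡) (point≡ (sym j≡) (snd≡ b)) (At.infinite-triple x b e l))
    where
    -- h - x = l and h′ - x = - f^ s l give h′ - h = - l - f^ s l = f^ (- s) l.
    l x : G
    l = f^ (line-∞ b 0F) (h′ - h)
    x = h - l
    l≡ : l ≡ h - x
    l≡ = prove v₁ (v₀ :- (v₀ :- v₁)) (h ∷ l ∷ []) refl
    snd≡ : ∀ b → let l = f^ (line-∞ b 0F) (h′ - h) in - f^ (line-∞ b 0F) l ≡ h′ - (h - l)
    snd≡ false = trans (cong -_ (f²≡ (h′ - h)))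
      (prove (:- :- (v₁ :- v₀ :+ v₂)) (v₁ :- (v₀ :- v₂)) (h ∷ h′ ∷ f (h′ - h) ∷ []) refl)
    snd≡ true  = trans (cong (-_ ∘ f) (f³ (h′ - h)))
      (trans (prove (:- v₂) (v₁ :- (v₀ :- (:- (v₁ :- v₀ :+ v₂)))) (h ∷ h′ ∷ f (h′ - h) ∷ []) refl)
        (cong (λ y → h′ - (h - y)) (sym (f²≡ (h′ - h)))))

  covered-double : ∀ m ((σ , e) : Unit) {i k a h₁ h₂ h₃} →
    i -₇ m ≡ just (σ , e) → k -₇ m ≡ just (opposite σ , rotate e) → G⁺ a → f a - a ≡ h₁ - h₂ →
    Covered (pt (i , h₁)) (pt (i , h₂)) (pt (k , h₃))
  covered-double m (σ , e) {a = a} {h₁} {h₂} {h₃} i≡ k≡ a∈ eq =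
    covered-by m x (At.InTriple-resp x (point≡ (sym i≡) refl) (point≡ (sym i≡) refl)
      (point≡ (sym k≡) third≡)
      (At.double-triple′ x (σ , e) a∈ (trans eq
        (prove (v₀ :- v₁) (v₀ :- v₂ :- (v₁ :- v₂)) (h₁ ∷ h₂ ∷ x ∷ []) refl))))
    where
    open ≡-Reasoning
    -- The condition a - f b = h₃ - x for b = h₁ - x + a reads f² b = h₃ - h₁ - 2a.
    w b x : G
    w = h₃ - h₁ - a - a
    b = f w
    x = h₁ + a - b
    fb≡ : f b ≡ - w - b
    fb≡ = begin
      f b                    ≡⟨ prove v₁ (:- :- (v₀ :+ v₁) :- v₀) (b ∷ f b ∷ []) refl ⟩
      - - (b + f b) - b      ≡⟨ cong (λ y → - y - b) (f²≡ b) ⟨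
      - f² b - b             ≡⟨ cong (λ y → - y - b) (f³ w) ⟩
      - w - b                ∎
    third≡ : a - f (h₁ - x + a) ≡ h₃ - x
    third≡ = begin
      a - f (h₁ - x + a)
        ≡⟨ cong (λ y → a - f y) (prove (v₀ :- (v₀ :+ v₁ :- v₂) :+ v₁) v₂ (h₁ ∷ a ∷ b ∷ []) refl) ⟩
      a - f b
        ≡⟨ cong (λ y → a - y) fb≡ ⟩
      a - (- w - b)
        ≡⟨ prove (v₁ :- (:- (v₂ :- v₀ :- v₁ :- v₁) :- v₃)) (v₂ :- (v₀ :+ v₁ :- v₃))
             (h₁ ∷ a ∷ h₃ ∷ b ∷ []) refl ⟩
      h₃ - x ∎

  -- The residues fix `m`; in each case `x` is found so that subtracting (m , x) turns the triple
  -- into a block of the base system at `x`.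
  covered-pattern : ∀ m {i j k i′ j′ k′ h₁ h₂ h₃} → Pattern i′ j′ k′ →
    i -₇ m ≡ i′ → j -₇ m ≡ j′ → k -₇ m ≡ k′ →
    let p₁ = pt (i , h₁); p₂ = pt (j , h₂); p₃ = pt (k , h₃) in
    p₁ ≢ p₂ → p₂ ≢ p₃ → p₁ ≢ p₃ → Covered p₁ p₂ p₃
  covered-pattern m {i} {j} {k} level i≡ j≡ k≡ p₁≢p₂ p₂≢p₃ p₁≢p₃
    with refl ← -₇≡nothing i m i≡ | refl ← -₇≡nothing j m j≡ | refl ← -₇≡nothing k m k≡ =
    covered-lift m (p₁≢p₂ ∘ cong (lift m)) (p₂≢p₃ ∘ cong (lift m)) (p₁≢p₃ ∘ cong (lift m))
  covered-pattern m {h₁ = h₁} {h₂} {h₃} (antipodal e) i≡ j≡ k≡ _ _ _ =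
    covered-by m x (At.InTriple-resp x
      (point≡ (sym i≡) refl)
      (point≡ (sym j≡) (+- (h₂ - x) (f u)))
      (point≡ (sym k≡) third≡)
      (At.antipodal-triple x e u (h₂ - x + f u)))
    where
    x u : G
    -- The coordinates of an antipodal block satisfy (h₂ - x) + (h₃ - x) = h₁ - x.
    x = h₂ + h₃ - h₁
    u = h₁ - x
    third≡ : - (h₂ - x + f u) - f² u ≡ h₃ - x
    third≡ = trans (cong (λ y → - (h₂ - x + f u) - y) (f²≡ u))
      (prove (:- (v₁ :- X :+ v₃) :- (:- ((v₀ :- X) :+ v₃))) (v₂ :- X) (h₁ ∷ h₂ ∷ h₃ ∷ f u ∷ []) refl)
      where X = v₁ :+ v₂ :- v₀
  covered-pattern m {h₁ = h₁} {h₂} {h₃} (triangle σ) i≡ j≡ k≡ _ _ _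
    -- The coordinates of a triangle block have sum 0, so 3 x is the sum of the three given ones.
    -- Condition (6) then finds `a` from the first two points, and the sum makes the third point
    -- fit.
    with x , 3x≡ ← third (h₁ + h₂ + h₃)
    with a , eq ← shift (h₁ - x) (h₂ - x) =
    covered-by m x (At.InTriple-resp x
      (point≡ (sym i≡) (-+ (h₁ - x) a))
      (point≡ (sym j≡) (trans (prove (v₀ :+ v₁) (v₁ :+ v₀) (f l ∷ f² a ∷ []) refl) eq))
      (point≡ (sym k≡) third≡)
      (At.triangle-triple x (σ , 0F) l a))
    where
    open ≡-Reasoning
    l = h₁ - x - a
    fl≡ : f l ≡ h₂ - x + (a + f a)
    fl≡ = begin
      f l                          ≡⟨ prove v₀ (v₁ :+ v₀ :- v₁) (f l ∷ f² a ∷ []) refl ⟩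
      f² a + f l - f² a            ≡⟨ cong₂ (λ y z → y - z) eq (f²≡ a) ⟩
      h₂ - x - - (a + f a)         ≡⟨ cong (h₂ - x +_) (⁻¹-involutive (a + f a)) ⟩
      h₂ - x + (a + f a)           ∎
    third≡ : f² l + f a ≡ h₃ - x
    third≡ = begin
      f² l + f a
        ≡⟨ cong (_+ f a) (f²≡ l) ⟩
      - (l + f l) + f a
        ≡⟨ cong (λ y → - (l + y) + f a) fl≡ ⟩
      - (l + (h₂ - x + (a + f a))) + f a
        ≡⟨ prove (:- (v₀ :- v₂ :- v₃ :+ (v₁ :- v₂ :+ (v₃ :+ v₄))) :+ v₄)
             (v₂ :+ v₂ :+ v₂ :- (v₀ :+ v₁ :+ v₂)) (h₁ ∷ h₂ ∷ x ∷ a ∷ f a ∷ []) refl ⟩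
      x + x + x - (h₁ + h₂ + x)
        ≡⟨ cong (_- (h₁ + h₂ + x)) 3x≡ ⟩
      h₁ + h₂ + h₃ - (h₁ + h₂ + x)
        ≡⟨ prove (v₀ :+ v₁ :+ v₃ :- (v₀ :+ v₁ :+ v₂)) (v₃ :- v₂) (h₁ ∷ h₂ ∷ x ∷ h₃ ∷ []) refl ⟩
      h₃ - x ∎
  covered-pattern m {i} {j} {h₁ = h₁} {h₂} {h₃} (double σ e) i≡ j≡ k≡ p₁≢p₂ _ _
    with refl ← -₇-injective i j m (trans i≡ (sym j≡))
    with At.orthogonal h₁ (At.-≢0 h₁ (p₁≢p₂ ∘ cong (λ h → pt (i , h))))
  ... | At.direct a a∈ eq   = covered-double m (σ , e) i≡ k≡ a∈ eq
  ... | At.reversed a a∈ eq = covered-swap (covered-double m (σ , e) i≡ k≡ a∈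
    (trans eq (prove (:- (v₀ :- v₁)) (v₁ :- v₀) (h₁ ∷ h₂ ∷ []) refl)))

  covered-arranged : ∀ {i j k h₁ h₂ h₃} → Arranged i j k →
    let p₁ = pt (i , h₁); p₂ = pt (j , h₂); p₃ = pt (k , h₃) in
    p₁ ≢ p₂ → p₂ ≢ p₃ → p₁ ≢ p₃ → Covered p₁ p₂ p₃
  covered-arranged (arranged m p) ≢₁₂ ≢₂₃ ≢₁₃ = covered-pattern m p refl refl refl ≢₁₂ ≢₂₃ ≢₁₃
  covered-arranged (rotated a) ≢₁₂ ≢₂₃ ≢₁₃ = covered-rotate (covered-rotate
    (covered-arranged a ≢₂₃ (≢-sym ≢₁₃) (≢-sym ≢₁₂)))
  covered-arranged (swapped a) ≢₁₂ ≢₂₃ ≢₁₃ = covered-swap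
    (covered-arranged a (≢-sym ≢₁₂) ≢₁₃ ≢₂₃)

  covered-∞ : ∀ b i h j h′ → _≢_ {A = Point} (pt (i , h)) (pt (j , h′)) →
    Covered (∞ b) (pt (i , h)) (pt (j , h′))
  covered-∞ b i h j h′ p≢q with i ≟₇ j
  ... | yes refl = covered-lift i (λ ()) (p≢q ∘ cong (lift i)) (λ ())
  ... | no i≢j with infinite-arrangement b i j i≢j
  ...   | inj₁ inf = covered-infinite b inf
  ...   | inj₂ inf = covered-rotate (covered-swap (covered-infinite b inf))

  covered-∞∞ : ∀ b b′ i h → _≢_ {A = Point} (∞ b) (∞ b′) → Covered (∞ b) (∞ b′) (pt (i , h))
  covered-∞∞ b b′ i h p≢q = covered-lift i (p≢q ∘ cong (lift i)) (λ ()) (λ ())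

  covers : ∀ {p q u} → p ≢ q → q ≢ u → p ≢ u → Covered p q u
  covers {∞ false} {∞ false} {∞ _} p≢q _ _ = contradiction refl p≢q
  covers {∞ true}  {∞ true}  {∞ _} p≢q _ _ = contradiction refl p≢q
  covers {∞ false} {∞ true}  {∞ false} _ _ p≢u = contradiction refl p≢u
  covers {∞ false} {∞ true}  {∞ true}  _ q≢u _ = contradiction refl q≢u
  covers {∞ true}  {∞ false} {∞ false} _ q≢u _ = contradiction refl q≢u
  covers {∞ true}  {∞ false} {∞ true}  _ _ p≢u = contradiction refl p≢u
  covers {∞ b} {∞ b′} {pt (i , h)} p≢q _ _ = covered-∞∞ b b′ i h p≢q
  covers {∞ b} {pt (i , h)} {∞ b′} _ _ p≢u = covered-rotate (covered-∞∞ b′ b i h (≢-sym p≢u))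
  covers {pt (i , h)} {∞ b} {∞ b′} _ q≢u _ =
    covered-rotate (covered-rotate (covered-∞∞ b b′ i h q≢u))
  covers {∞ b} {pt (i , h)} {pt (j , h′)} _ q≢u _ = covered-∞ b i h j h′ q≢u
  covers {pt (i , h)} {∞ b} {pt (j , h′)} _ _ p≢u = covered-swap (covered-∞ b i h j h′ p≢u)
  covers {pt (i , h)} {pt (j , h′)} {∞ b} p≢q _ _ = covered-rotate (covered-∞ b i h j h′ p≢q)
  covers {pt (i , _)} {pt (j , _)} {pt (k , _)} = covered-arranged (arrangement i j k)

  large-set : KirkmanLargeSet (Z₇ × G) Class Point
  large-set = record { next = next ; next³ = next³ ; joins = joins ; covers = covers′ }
    where
    covers′ : ∀ {p q u} → p ≢ q → q ≢ u → p ≢ u → ∃₂ λ s c → Block (next s c) p q u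
    covers′ p≢q q≢u p≢u = let c = covers p≢q q≢u p≢u in
      Covered.system c , Covered.class c , Covered.block c

open import Data.Nat.Base using (_+_; _*_; _%_; _<_)

-- Cardinalities

⊎-finite : ∀ {A B : Set} {m n} → A ↔ Fin m → B ↔ Fin n → (A ⊎ B) ↔ Fin (m + n)
⊎-finite a b = ↔-sym +↔⊎ ↔-∘ (a ⊎-↔ b)

×-finite : ∀ {A B : Set} {m n} → A ↔ Fin m → B ↔ Fin n → (A × B) ↔ Fin (m * n)
×-finite a b = ↔-sym *↔× ↔-∘ (a ×-↔ b)

Maybe-finite : ∀ {A : Set} {n} → A ↔ Fin n → Maybe A ↔ Fin (suc n)
Maybe-finite a = ⊎-finite (↔-sym 1↔⊤) a ↔-∘ mk↔ₛ′
  (λ { nothing → inj₁ tt ; (just x) → inj₂ x }) (λ { (inj₁ tt) → nothing ; (inj₂ x) → just x })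
  (λ { (inj₁ tt) → refl ; (inj₂ x) → refl }) (λ { nothing → refl ; (just x) → refl })

Ext-finite : ∀ {A : Set} {n} → A ↔ Fin n → Ext A ↔ Fin (n + 2)
Ext-finite a = ⊎-finite a (↔-sym 2↔Bool) ↔-∘ mk↔ₛ′
  (λ { (∞ b) → inj₂ b ; (pt x) → inj₁ x }) (λ { (inj₂ b) → ∞ b ; (inj₁ x) → pt x })
  (λ { (inj₁ x) → refl ; (inj₂ b) → refl }) (λ { (∞ b) → refl ; (pt x) → refl })

Sign-finite : Sign ↔ Fin 2
Sign-finite = mk↔ₛ′ (λ { ⁺ → 0F ; ⁻ → 1F }) (λ { 0F → ⁺ ; 1F → ⁻ })
  (λ { 0F → refl ; 1F → refl }) (λ { ⁺ → refl ; ⁻ → refl })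

Unit-finite : Unit ↔ Fin 6
Unit-finite = ×-finite Sign-finite ↔-refl

odd-half : ∀ {v} c → v ≡ suc (c * 2) → (v ∸ 1) / 2 ≡ c
odd-half c refl = m*n/n≡m c 2

odd-double : ∀ {v} c → v ≡ suc (c * 2) → v ≡ suc ((v ∸ 1) / 2 + (v ∸ 1) / 2)
odd-double c v≡ = trans v≡ (cong suc (trans (c*2≡c+c c)
  (cong₂ _+_ (sym (odd-half c v≡)) (sym (odd-half c v≡)))))
  where
  c*2≡c+c : ∀ c → c * 2 ≡ c + c
  c*2≡c+c = solve-∀

module _ {q} (C : CubicOrthomorphism q) where
  open Discretise C using (r; discrete)
  open DiscreteOrthomorphism discrete using (isAbelianGroup; Trisectible; place↔; 0#; -_)
    renaming (_+_ to _⊕_)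
  open AbelianSolver isAbelianGroup

  q≡1+6r : q ≡ suc (6 * r)
  q≡1+6r = sym (↔⇒≡ (place↔ ↔-∘ ↔-sym (Maybe-finite (×-finite Unit-finite ↔-refl))))

  private
    group : AbelianGroup 0ℓ 0ℓ
    group = record { isAbelianGroup = isAbelianGroup }
  open AbelianGroup group using (monoid; commutativeMonoid)
  open AbelianGroupProperties group using (∙-cancelˡ)
  open MonoidMult monoid using (×-assocˡ) renaming (_×_ to _·_)
  open CommutativeMonoidSum commutativeMonoid using (sum; sum-permute; ∑-distrib-+; sum-replicate)

  -- Translation by a permutes the group, so the sum of all elements is unchanged by adding q · a.
  order-annihilates : ∀ a → q · a ≡ 0#
  order-annihilates a = ∙-cancelˡ total _ _ (begin
    total ⊕ q · a                        ≡⟨ cong (total ⊕_) (sum-replicate q) ⟨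
    total ⊕ sum {q} (λ _ → a)            ≡⟨ ∑-distrib-+ {q} (λ x → x) (λ _ → a) ⟨
    sum {q} (λ x → x ⊕ a)                ≡⟨ sum-permute {q} (λ x → x) translation ⟨
    total                                ≡⟨ prove v₀ (v₀ :+ :0) (total ∷ []) refl ⟩
    total ⊕ 0#                           ∎)
    where
    open ≡-Reasoning
    total = sum {q} (λ x → x)
    translation : Fin q ↔ Fin q
    translation = mk↔ₛ′ (_⊕ a) (_⊕ (- a))
      (λ x → prove (v₀ :- v₁ :+ v₁) v₀ (x ∷ a ∷ []) refl)
      (λ x → prove (v₀ :+ v₁ :- v₁) v₀ (x ∷ a ∷ []) refl)

  -- As 1 + 3 · 2r = q annihilates `a`, the element -(2r · a) is a third of it.
  trisectible : Trisectible
  trisectible a = - y , (begin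
    ((- y) ⊕ (- y)) ⊕ (- y)
      ≡⟨ prove (:- v₀ :- v₀ :- v₀) (v₁ :- (v₁ :+ (v₀ :+ (v₀ :+ (v₀ :+ :0))))) (y ∷ a ∷ []) refl ⟩
    a ⊕ (- (a ⊕ 3 · y))         ≡⟨ cong (λ x → a ⊕ (- (a ⊕ x))) (×-assocˡ a 3 (2 * r)) ⟩
    a ⊕ (- (a ⊕ (3 * (2 * r)) · a))
      ≡⟨ cong (λ n → a ⊕ (- (n · a))) (trans (cong suc (six r)) (sym q≡1+6r)) ⟩
    a ⊕ (- (q · a))             ≡⟨ cong (λ x → a ⊕ (- x)) (order-annihilates a) ⟩
    a ⊕ (- 0#)                  ≡⟨ prove (v₀ :- :0) v₀ (a ∷ []) refl ⟩
    a                           ∎)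
    where
    open ≡-Reasoning
    y = (2 * r) · a
    six : ∀ r → 3 * (2 * r) ≡ 6 * r
    six = solve-∀

  Shifts : Set
  Shifts = Maybe (Fin 3 × Fin r)

  Shifts-finite : Shifts ↔ Fin (suc (3 * r))
  Shifts-finite = Maybe-finite (×-finite ↔-refl ↔-refl)

  small-order : q + 2 ≡ suc (suc (3 * r) * 2)
  small-order = trans (cong (_+ 2) q≡1+6r) (arithmetic r)
    where
    arithmetic : ∀ r → suc (6 * r) + 2 ≡ suc (suc (3 * r) * 2)
    arithmetic = solve-∀

  -- Each large system has 1 + 3r classes that extend those of the KTS(q + 2), and three for each of
  -- the q lines.
  large-order : 7 * q + 2 ≡ suc ((suc (3 * r) + q * 3) * 2)
  large-order = subst (λ n → 7 * n + 2 ≡ suc ((suc (3 * r) + n * 3) * 2)) (sym q≡1+6r) (arithmetic r)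
    where
    arithmetic : ∀ r → 7 * suc (6 * r) + 2 ≡ suc ((suc (3 * r) + suc (6 * r) * 3) * 2)
    arithmetic = solve-∀

-- Assembly of the LKTS(7q + 2)

theorem3p6 : (q : ℕ) → 0 < q → q % 6 ≡ 1 →
    LKTS (q + 2) → CubicOrthomorphism q → LKTS (7 * q + 2)
theorem3p6 q _ _ L C = toLKTS (two-more (7 * q)) (odd-double large-half (large-order C))
  (relabel
    (subst (λ n → (Z₇ × Fin q) ↔ Fin n) (sym (m+n∸n≡m (7 * q) 2))
      (×-finite (Maybe-finite Unit-finite) ↔-refl))
    (subst (λ n → (Shifts C ⊎ (Fin q × Fin 3)) ↔ Fin n) (sym (odd-half large-half (large-order C)))
      (⊎-finite (Shifts-finite C) (×-finite ↔-refl ↔-refl)))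
    (Ext-finite (×-finite (Maybe-finite Unit-finite) ↔-refl))
    (LargeSet.large-set (Discretise.discrete C) (trisectible C) sub))
  where
  open Discretise C using (r)
  small-half large-half : ℕ
  small-half = suc (3 * r)
  large-half = suc (3 * r) + q * 3
  two-more : ∀ n → n + 2 ≡ 2 + (n + 2 ∸ 2)
  two-more n = trans (+-comm n 2) (cong (2 +_) (sym (m+n∸n≡m n 2)))
  sub : KirkmanLargeSet (Fin q) (Shifts C) (Ext (Fin q))
  sub = relabel
    (subst (λ n → Fin n ↔ Fin q) (sym (m+n∸n≡m q 2)) ↔-refl)
    (subst (λ n → Fin n ↔ Shifts C) (sym (odd-half small-half (small-order C))) (↔-sym (Shifts-finite C)))
    (↔-sym (Ext-finite ↔-refl))
    (fromLKTS (two-more q) L)
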